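{- For infinitely many positive integers $t$, \[\tilde{r}(t) \leq 1.001^{ -t} \binom{r(t)}{2}.\]
   Context: $r(t)$ denotes the diagonal Ramsey number of $K_t$: the smallest $n$ such that every red/blue colouring of the edges of $K_n$ contains a monochromatic copy of $K_t$. The on-line Ramsey number $\tilde{r}(G)$ of a graph $G$ is defined via the following game between Builder and Painter, played on an initially edgeless graph with an unlimited supply of vertices: in each round Builder draws a new edge (between any two vertices not yet joined), and Painter immediately colours it red or blue. Builder wins once the coloured graph contains a monochromatic copy of $G$. $\tilde{r}(G)$ is the minimum number of edges Builder must draw to guarantee a win, regardless of Painter's strategy. We write $\tilde{r}(t) = \tilde{r}(K_t)$. -}

module Defs where

open import Data.Nat using (ℕ; zero; suc; _<_)
open import Data.Bool using (Bool)
open import Data.Fin using (Fin)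
open import Data.Product using (_×_; _,_; ∃)
open import Data.Sum using (_⊎_)
open import Data.List using (List; []; _∷_)
open import Data.List.Membership.Propositional using (_∈_)
open import Relation.Nullary using (¬_)
open import Relation.Binary.PropositionalEquality using (_≡_; _≢_)
open import Function.Definitions using (Injective)

-- Colours: Bool (true = red, false = blue).

-- A red/blue colouring of the edges of K_n: a symmetric function on
-- pairs of vertices (values on the diagonal are irrelevant).
record Colouring (n : ℕ) : Set where
  field
    col : Fin n → Fin n → Bool
    sym : ∀ i j → col i j ≡ col j i
open Colouring public

HasMonoClique : ∀ {n} (t : ℕ) → Colouring n → Set
HasMonoClique {n} t c =
  ∃ λ (f : Fin t → Fin n) → Injective _≡_ _≡_ f × ∃ λ (b : Bool) →
    ∀ x y → x ≢ y → col c (f x) (f y) ≡ b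

Arrows : ℕ → ℕ → Set
Arrows n t = (c : Colouring n) → HasMonoClique t c

IsRamsey : ℕ → ℕ → Set
IsRamsey t n = Arrows n t × (∀ m → m < n → ¬ Arrows m t)

-- a coloured edge drawn by Builder: endpoints (vertices are naturals,
-- an unlimited supply) and the colour Painter gave it
CEdge : Set
CEdge = ℕ × ℕ × Bool

Joined : ℕ → ℕ → List CEdge → Set
Joined u v S = ∃ λ (b : Bool) → ((u , v , b) ∈ S) ⊎ ((v , u , b) ∈ S)

HasMono : ℕ → List CEdge → Set
HasMono t S =
  ∃ λ (f : Fin t → ℕ) → Injective _≡_ _≡_ f × ∃ λ (b : Bool) →
    ∀ x y → x ≢ y → ((f x , f y , b) ∈ S) ⊎ ((f y , f x , b) ∈ S)

-- BuilderWins t k S : from the position S (the coloured graph so far),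
-- Builder can force a monochromatic K_t by drawing at most k more edges,
-- whatever Painter does.
data BuilderWins (t : ℕ) : ℕ → List CEdge → Set where
  done : ∀ {k S} → HasMono t S → BuilderWins t k S
  move : ∀ {k S} (u v : ℕ) → u ≢ v → ¬ Joined u v S →
         (∀ (b : Bool) → BuilderWins t k ((u , v , b) ∷ S)) →
         BuilderWins t (suc k) S

IsOnlineRamsey : ℕ → ℕ → Set
IsOnlineRamsey t m = BuilderWins t m [] × (∀ k → k < m → ¬ BuilderWins t k [])

{-# OPTIONS --safe #-}
-- Suppose 2^σ r(k) ≤ r(t) with t = k + s and s = 4σ. Starting from many vertices, Builder repeatedly joins
-- a vertex to all remaining ones and keeps only one colour class, as in the Erdős–Szekeres argument. In a
-- first run the blue class is kept as soon as it is not very small: this ends with a red K_t or with s vertices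
-- joined to each other and to everything that remains in blue. A second run with the colours exchanged yields the same
-- in red, so that a monochromatic K_k among the remaining vertices completes a K_t, and r(k) of them suffice.
-- The two runs cost about C(t + s, s)² r(k) edges, which is far below r(t)² because s is a small fraction of t
-- and r(t) ≥ 2^(t/2 - 1); the last stage costs C(r(k), 2), smaller than C(r(t), 2) by a factor 4^σ.
-- A suitable t exists between 132σ and 1024σ because r(128σ) ≤ 2^(256σ) while r(1024σ) ≥ 2^(512σ - 1).
-- All the numbers involved are computable: untouched vertices are interchangeable, so the game is decidable.
module Submission where

open import Defs
open import Data.Nat using (ℕ; _≤_; _<_; _*_; _^_)
open import Data.Nat.Combinatorics using (_C_)
open import Data.Product using (_×_; ∃)

open import Data.Bool using (Bool; true; false; not; if_then_else_)
import Data.Bool.Properties as Bool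
open import Data.Fin as Fin using (Fin; zero; suc; inject≤; finToFun; funToFin; fromℕ<; toℕ)
import Data.Fin.Properties as Fin
open import Data.Fin.Subset using (Subset; inside; outside; ∣_∣) renaming (⊥ to ∅; _∈_ to _∈ₛ_; _∉_ to _∉ₛ_)
open import Data.Fin.Subset.Properties using (anySubset?; ∉⊥; ∣⊥∣≡0)
open import Data.List as List using (List; []; _∷_; length; upTo)
open import Data.List.Membership.Propositional using (_∈_)
import Data.List.Membership.DecPropositional as DecMembership
open import Data.List.Membership.Propositional.Properties using (∈-lookup; ∈-map⁺; ∈-map⁻; ∈-++⁺ˡ; ∈-++⁺ʳ)
import Data.List.Properties as List
open import Data.List.Relation.Binary.Sublist.Propositional using ([]; _∷_; _∷ʳ_; minimum; ⊆-refl) renaming (_⊆_ to _⊑_; ⊆-trans to ⊑-trans)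
open import Data.List.Relation.Binary.Sublist.Propositional.Properties using (All-resp-⊆; take-⊆; length-mono-≤)
open import Data.List.Relation.Binary.Subset.Propositional using (_⊆_)
open import Data.List.Relation.Unary.All as All using (All; []; _∷_)
import Data.List.Relation.Unary.All.Properties as All
open import Data.List.Relation.Unary.AllPairs as AllPairs using (AllPairs; []; _∷_)
import Data.List.Relation.Unary.AllPairs.Properties as AllPairs
open import Data.List.Relation.Unary.Any using (here; there)
open import Data.List.Relation.Unary.Unique.Propositional using (Unique)
open import Data.List.Relation.Unary.Unique.Propositional.Properties using (upTo⁺)
open import Data.Maybe using (Maybe; just; nothing)
open import Data.Nat using (zero; suc; _+_; _∸_; _⊔_; z≤n; s≤s; _≤?_; NonZero)
open import Data.Nat.Combinatorics using (nCk+nC[k+1]≡[n+1]C[k+1]; nC1≡n)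
open import Data.Nat.ListAction using (sum)
open import Data.Nat.Properties
open import Data.Nat.Tactic.RingSolver using (solve-∀)
open import Data.Product using (_,_; proj₁; proj₂)
open import Data.Product.Properties using (≡-dec)
open import Data.Sum using (_⊎_; inj₁; inj₂)
open import Data.Vec as Vec using (Vec; []; _∷_; take; drop)
import Data.Vec.Properties as Vec
open import Function using (_∘_; id)
open import Function.Definitions using (Injective)
open import Relation.Binary.Definitions using (Symmetric)
open import Relation.Binary.PropositionalEquality as ≡ hiding (sym; [_])
open import Relation.Nullary using (¬_; Dec; yes; no; contradiction)
open import Relation.Nullary.Decidable using (map′; decidable-stable; _×-dec_; _⊎-dec_; _→-dec_; ¬?)
open import Relation.Unary using (Decidable)

-- Triangular numbers

tri : ℕ → ℕ
tri zero    = 0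
-- This recursion splits `Vec Bool (tri (suc n))` definitionally into a first row of length `n` and
-- a smaller triangle, as `take n` and `drop n` require.
tri (suc n) = n + tri n

tri≡nC2 : ∀ n → tri n ≡ n C 2
tri≡nC2 zero    = refl
tri≡nC2 (suc n) = begin
  n + tri n      ≡⟨ cong₂ _+_ (≡.sym (nC1≡n n)) (tri≡nC2 n) ⟩
  n C 1 + n C 2  ≡⟨ nCk+nC[k+1]≡[n+1]C[k+1] n 1 ⟩
  suc n C 2      ∎
  where open ≡-Reasoning

tri-double : ∀ n → tri n + tri n + n ≡ n * n
tri-double zero    = refl
tri-double (suc n) = begin
  n + tri n + (n + tri n) + suc n       ≡⟨ rearrange n (tri n) ⟩
  (tri n + tri n + n) + (n + n + 1)     ≡⟨ cong (_+ (n + n + 1)) (tri-double n) ⟩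
  n * n + (n + n + 1)                   ≡⟨ square n ⟩
  suc n * suc n                         ∎
  where
  open ≡-Reasoning
  rearrange : ∀ n x → n + x + (n + x) + suc n ≡ (x + x + n) + (n + n + 1)
  rearrange = solve-∀
  square : ∀ n → n * n + (n + n + 1) ≡ suc n * suc n
  square = solve-∀

-- The exponential lower bound for r(t)

-- A partial assignment: `just b` prescribes a bit and `nothing` leaves it free.
Pattern : ℕ → Set
Pattern = Vec (Maybe Bool)

Matches : ∀ {m} → Pattern m → Vec Bool m → Set
Matches c v = ∀ i b → Vec.lookup c i ≡ just b → Vec.lookup v i ≡ b

-- The number of Boolean vectors that match the pattern.
weight : ∀ {m} → Pattern m → ℕ
weight []            = 1
weight (nothing ∷ c) = weight c + weight c
weight (just _ ∷ c)  = weight c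

total : ∀ {m} → List (Pattern m) → ℕ
total = sum ∘ List.map weight

restrict : ∀ {m} → Bool → List (Pattern (suc m)) → List (Pattern m)
restrict b []                        = []
restrict b ((nothing ∷ c) ∷ L)       = c ∷ restrict b L
restrict true  ((just true ∷ c) ∷ L)  = c ∷ restrict true L
restrict true  ((just false ∷ c) ∷ L) = restrict true L
restrict false ((just true ∷ c) ∷ L)  = restrict false L
restrict false ((just false ∷ c) ∷ L) = c ∷ restrict false L

total-restrict : ∀ {m} (L : List (Pattern (suc m))) →
                 total (restrict true L) + total (restrict false L) ≡ total L
total-restrict []                     = refl
total-restrict ((nothing ∷ c) ∷ L)    = begin
  weight c + x + (weight c + y)   ≡⟨ swap (weight c) x y ⟩
  weight c + weight c + (x + y)   ≡⟨ cong (weight c + weight c +_) (total-restrict L) ⟩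
  weight c + weight c + total L   ∎
  where
  open ≡-Reasoning
  x = total (restrict true L)
  y = total (restrict false L)
  swap : ∀ w x y → w + x + (w + y) ≡ w + w + (x + y)
  swap = solve-∀
total-restrict ((just true ∷ c) ∷ L)  =
  trans (+-assoc (weight c) _ _) (cong (weight c +_) (total-restrict L))
total-restrict ((just false ∷ c) ∷ L) = begin
  x + (weight c + y)  ≡⟨ swap (weight c) x y ⟩
  weight c + (x + y)  ≡⟨ cong (weight c +_) (total-restrict L) ⟩
  weight c + total L  ∎
  where
  open ≡-Reasoning
  x = total (restrict true L)
  y = total (restrict false L)
  swap : ∀ w x y → x + (w + y) ≡ w + (x + y)
  swap = solve-∀

restrict-complete : ∀ {m} b (v : Vec Bool m) L {c} → c ∈ L → Matches c (b ∷ v) →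
                    ∃ λ c′ → c′ ∈ restrict b L × Matches c′ v
restrict-complete b v ((nothing ∷ c) ∷ L) (here refl) M = c , here refl , M ∘ suc
restrict-complete b v ((nothing ∷ c) ∷ L) (there c∈L) M =
  let c′ , c′∈ , M′ = restrict-complete b v L c∈L M in c′ , there c′∈ , M′
restrict-complete true  v ((just true ∷ c) ∷ L)  (here refl) M = c , here refl , M ∘ suc
restrict-complete false v ((just false ∷ c) ∷ L) (here refl) M = c , here refl , M ∘ suc
restrict-complete true  v ((just false ∷ c) ∷ L) (here refl) M = contradiction (M zero _ refl) λ ()
restrict-complete false v ((just true ∷ c) ∷ L)  (here refl) M = contradiction (M zero _ refl) λ ()
restrict-complete true  v ((just true ∷ c) ∷ L)  (there c∈L) M =
  let c′ , c′∈ , M′ = restrict-complete true v L c∈L M in c′ , there c′∈ , M′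
restrict-complete false v ((just false ∷ c) ∷ L) (there c∈L) M =
  let c′ , c′∈ , M′ = restrict-complete false v L c∈L M in c′ , there c′∈ , M′
restrict-complete true  v ((just false ∷ c) ∷ L) (there c∈L) M = restrict-complete true v L c∈L M
restrict-complete false v ((just true ∷ c) ∷ L)  (there c∈L) M = restrict-complete false v L c∈L M

-- The first-moment method, derandomised by conditional expectations: the two
-- restrictions share the total weight, so one of them stays below 2 ^ m.
avoid : ∀ m (L : List (Pattern m)) → total L < 2 ^ m → ∃ λ v → ∀ {c} → c ∈ L → ¬ Matches c v
avoid zero    []       _ = [] , λ ()
avoid zero    ([] ∷ L) (s≤s ())
avoid (suc m) L total< with total (restrict true L) <? 2 ^ m
... | yes lt = let v , ok = avoid m (restrict true L) lt in
  true ∷ v , λ c∈L M → let _ , c′∈ , M′ = restrict-complete true v L c∈L M in ok c′∈ M′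
... | no ≮ = let v , ok = avoid m (restrict false L) lt in
  false ∷ v , λ c∈L M → let _ , c′∈ , M′ = restrict-complete false v L c∈L M in ok c′∈ M′
  where
  lt : total (restrict false L) < 2 ^ m
  lt = +-cancelˡ-< (2 ^ m) _ _ (begin-strict
    2 ^ m + total (restrict false L)                    ≤⟨ +-monoˡ-≤ _ (≮⇒≥ ≮) ⟩
    total (restrict true L) + total (restrict false L)  ≡⟨ total-restrict L ⟩
    total L                                             <⟨ total< ⟩
    2 ^ m + (2 ^ m + 0)                                 ≡⟨ cong (2 ^ m +_) (+-identityʳ (2 ^ m)) ⟩
    2 ^ m + 2 ^ m                                       ∎)
    where open ≤-Reasoning

-- A colouring of K_n is stored as the rows of the strict upper triangle of its matrix.

cell : ∀ {n} → Vec Bool (tri n) → Fin n → Fin n → Bool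
cell v zero zero = false
cell {suc n} v zero    (suc j) = Vec.lookup (take n v) j
cell {suc n} v (suc i) zero    = Vec.lookup (take n v) i
cell {suc n} v (suc i) (suc j) = cell (drop n v) i j

cell-sym : ∀ {n} (v : Vec Bool (tri n)) (i j : Fin n) → cell v i j ≡ cell v j i
cell-sym v zero    zero    = refl
cell-sym v zero    (suc j) = refl
cell-sym v (suc i) zero    = refl
cell-sym {suc n} v (suc i) (suc j) = cell-sym (drop n v) i j

decode : ∀ {n} → Vec Bool (tri n) → Colouring n
decode {n} v = record { col = cell {n} v ; sym = cell-sym {n} v }

requirement : Bool → Bool → Maybe Bool
requirement b inside  = just b
requirement b outside = nothing

cliquePattern : ∀ {n} → Bool → Subset n → Pattern (tri n)
cliquePattern b []                    = []
cliquePattern b (inside ∷ p)          = Vec.map (requirement b) p Vec.++ cliquePattern b p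
cliquePattern {suc n} b (outside ∷ p) = Vec.replicate n nothing Vec.++ cliquePattern b p

weight-++ : ∀ {m n} (c : Pattern m) (d : Pattern n) → weight (c Vec.++ d) ≡ weight c * weight d
weight-++ []            d = ≡.sym (+-identityʳ (weight d))
weight-++ (nothing ∷ c) d = trans (cong₂ _+_ (weight-++ c d) (weight-++ c d)) (≡.sym (*-distribʳ-+ (weight d) (weight c) (weight c)))
weight-++ (just _ ∷ c)  d = weight-++ c d

double : ∀ n → n + n ≡ 2 * n
double = solve-∀

weight-free : ∀ n → weight (Vec.replicate n nothing) ≡ 2 ^ n
weight-free zero    = refl
weight-free (suc n) = trans (double (weight (Vec.replicate n nothing))) (cong (2 *_) (weight-free n))

weight-row : ∀ {n} b (p : Subset n) → weight (Vec.map (requirement b) p) * 2 ^ ∣ p ∣ ≡ 2 ^ n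
weight-row b []            = refl
weight-row b (inside ∷ p)  = trans (swap (weight (Vec.map (requirement b) p)) (2 ^ ∣ p ∣)) (cong (2 *_) (weight-row b p))
  where
  swap : ∀ w x → w * (2 * x) ≡ 2 * (w * x)
  swap = solve-∀
weight-row b (outside ∷ p) = trans (swap (weight (Vec.map (requirement b) p)) (2 ^ ∣ p ∣)) (cong (2 *_) (weight-row b p))
  where
  swap : ∀ w x → (w + w) * x ≡ 2 * (w * x)
  swap = solve-∀

-- A clique on `p` prescribes `tri ∣ p ∣` of the `tri n` cells and leaves the others free. The
-- product form avoids a subtraction of exponents.
weight-cliquePattern : ∀ {n} b (p : Subset n) → weight (cliquePattern b p) * 2 ^ tri ∣ p ∣ ≡ 2 ^ tri n
weight-cliquePattern b [] = refl
weight-cliquePattern {suc n} b (inside ∷ p) = begin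
  weight (row Vec.++ rest) * 2 ^ (∣ p ∣ + tri ∣ p ∣)
    ≡⟨ cong₂ _*_ (weight-++ row rest) (^-distribˡ-+-* 2 ∣ p ∣ (tri ∣ p ∣)) ⟩
  (weight row * weight rest) * (2 ^ ∣ p ∣ * 2 ^ tri ∣ p ∣)
    ≡⟨ [m*n]*[o*p]≡[m*o]*[n*p] (weight row) (weight rest) (2 ^ ∣ p ∣) (2 ^ tri ∣ p ∣) ⟩
  (weight row * 2 ^ ∣ p ∣) * (weight rest * 2 ^ tri ∣ p ∣)
    ≡⟨ cong₂ _*_ (weight-row b p) (weight-cliquePattern b p) ⟩
  2 ^ n * 2 ^ tri n
    ≡⟨ ^-distribˡ-+-* 2 n (tri n) ⟨
  2 ^ (n + tri n) ∎
  where
  open ≡-Reasoning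
  row  = Vec.map (requirement b) p
  rest = cliquePattern b p
weight-cliquePattern {suc n} b (outside ∷ p) = begin
  weight (row Vec.++ rest) * 2 ^ tri ∣ p ∣      ≡⟨ cong (_* 2 ^ tri ∣ p ∣) (weight-++ row rest) ⟩
  weight row * weight rest * 2 ^ tri ∣ p ∣      ≡⟨ *-assoc (weight row) (weight rest) _ ⟩
  weight row * (weight rest * 2 ^ tri ∣ p ∣)    ≡⟨ cong₂ _*_ (weight-free n) (weight-cliquePattern b p) ⟩
  2 ^ n * 2 ^ tri n                             ≡⟨ ^-distribˡ-+-* 2 n (tri n) ⟨
  2 ^ (n + tri n)                               ∎
  where
  open ≡-Reasoning
  row  = Vec.replicate n nothing
  rest = cliquePattern b p

matches-++ : ∀ m {n} (c : Pattern m) {d : Pattern n} v →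
             Matches c (take m v) → Matches d (drop m v) → Matches (c Vec.++ d) v
matches-++ zero    []      v       Mc Md = Md
matches-++ (suc m) (x ∷ c) (y ∷ v) Mc Md zero    = Mc zero
matches-++ (suc m) (x ∷ c) (y ∷ v) Mc Md (suc i) = matches-++ m c v (Mc ∘ suc) Md i

requirement-inside : ∀ {n} b b′ (p : Subset n) i →
                     Vec.lookup (Vec.map (requirement b) p) i ≡ just b′ → i ∈ₛ p × b ≡ b′
requirement-inside b b′ (inside ∷ p)  zero refl = Vec.here , refl
requirement-inside b b′ (_ ∷ p) (suc i) eq =
  let i∈p , b≡b′ = requirement-inside b b′ p i eq in Vec.there i∈p , b≡b′

matches-cliquePattern : ∀ {n} b (p : Subset n) v →
  (∀ {i j} → i ∈ₛ p → j ∈ₛ p → i ≢ j → cell v i j ≡ b) → Matches (cliquePattern b p) v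
matches-cliquePattern b [] [] mono ()
matches-cliquePattern {suc n} b (inside ∷ p) v mono =
  matches-++ n (Vec.map (requirement b) p) v
    (λ i b′ eq → let i∈p , b≡b′ = requirement-inside b b′ p i eq in
      trans (mono {zero} {suc i} Vec.here (Vec.there i∈p) λ ()) b≡b′)
    (matches-cliquePattern b p (drop n v) λ i∈p j∈p i≢j →
      mono (Vec.there i∈p) (Vec.there j∈p) (i≢j ∘ Fin.suc-injective))
matches-cliquePattern {suc n} b (outside ∷ p) v mono =
  matches-++ n (Vec.replicate n nothing) v
    (λ i b′ eq → contradiction (trans (≡.sym (Vec.lookup-replicate i nothing)) eq) λ ())
    (matches-cliquePattern b p (drop n v) λ i∈p j∈p i≢j →
      mono (Vec.there i∈p) (Vec.there j∈p) (i≢j ∘ Fin.suc-injective))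

subsets : ∀ n → ℕ → List (Subset n)
subsets zero    zero    = [] ∷ []
subsets zero    (suc t) = []
subsets (suc n) zero    = List.map (outside ∷_) (subsets n zero)
subsets (suc n) (suc t) = List.map (inside ∷_) (subsets n t) List.++ List.map (outside ∷_) (subsets n (suc t))

∈-subsets : ∀ {n} (p : Subset n) → p ∈ subsets n ∣ p ∣
∈-subsets []           = here refl
∈-subsets (inside ∷ p) = ∈-++⁺ˡ (∈-map⁺ (inside ∷_) (∈-subsets p))
∈-subsets {suc n} (outside ∷ p) with ∣ p ∣ | ∈-subsets p
... | zero  | p∈ = ∈-map⁺ (outside ∷_) p∈
... | suc t | p∈ = ∈-++⁺ʳ (List.map (inside ∷_) (subsets n t)) (∈-map⁺ (outside ∷_) p∈)

subsets-size : ∀ n t → All (λ p → ∣ p ∣ ≡ t) (subsets n t)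
subsets-size zero    zero    = refl ∷ []
subsets-size zero    (suc t) = []
subsets-size (suc n) zero    = All.map⁺ (subsets-size n zero)
subsets-size (suc n) (suc t) =
  All.++⁺ (All.map⁺ (All.map (cong suc) (subsets-size n t))) (All.map⁺ (subsets-size n (suc t)))

-- This crude bound in place of the binomial coefficient still gives r(t) > 2^(t/2 - 1) for even t ≥
-- 4.
length-subsets : ∀ n t → length (subsets n t) ≤ n ^ t
length-subsets zero    zero    = ≤-refl
length-subsets zero    (suc t) = z≤n
length-subsets (suc n) zero    = ≤-trans (≤-reflexive (List.length-map _ (subsets n zero))) (length-subsets n zero)
length-subsets (suc n) (suc t) = begin
  length (List.map (inside ∷_) (subsets n t) List.++ List.map (outside ∷_) (subsets n (suc t)))
    ≡⟨ List.length-++ (List.map (inside ∷_) (subsets n t)) ⟩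
  length (List.map (inside ∷_) (subsets n t)) + length (List.map (outside ∷_) (subsets n (suc t)))
    ≡⟨ cong₂ _+_ (List.length-map _ (subsets n t)) (List.length-map _ (subsets n (suc t))) ⟩
  length (subsets n t) + length (subsets n (suc t))
    ≤⟨ +-mono-≤ (length-subsets n t) (length-subsets n (suc t)) ⟩
  n ^ t + n * n ^ t      ≤⟨ *-monoʳ-≤ (suc n) (^-monoˡ-≤ t (n≤1+n n)) ⟩
  suc n * suc n ^ t      ∎
  where open ≤-Reasoning

insert : ∀ {n} (p : Subset n) i → i ∉ₛ p →
         ∃ λ q → ∣ q ∣ ≡ suc ∣ p ∣ × (∀ {j} → j ∈ₛ q → j ≡ i ⊎ j ∈ₛ p)
insert (inside ∷ p)  zero i∉p = contradiction Vec.here i∉p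
insert (outside ∷ p) zero i∉p = inside ∷ p , refl , λ { Vec.here → inj₁ refl ; (Vec.there j∈) → inj₂ (Vec.there j∈) }
insert (x ∷ p) (suc i) i∉p with insert p i (i∉p ∘ Vec.there)
... | q , size , back = x ∷ q , grow x , λ { Vec.here → inj₂ Vec.here ; (Vec.there j∈) → lift (back j∈) }
  where
  grow : ∀ x → ∣ x ∷ q ∣ ≡ suc ∣ x ∷ p ∣
  grow inside  = cong suc size
  grow outside = size
  lift : ∀ {j} → j ≡ i ⊎ j ∈ₛ p → suc j ≡ suc i ⊎ suc j ∈ₛ x ∷ p
  lift (inj₁ eq) = inj₁ (cong suc eq)
  lift (inj₂ j∈) = inj₂ (Vec.there j∈)

-- Translates the injections of `HasMonoClique` into the subsets that index the clique patterns;
-- injectivity keeps the size exact.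
image : ∀ {t n} (f : Fin t → Fin n) → Injective _≡_ _≡_ f →
        ∃ λ p → ∣ p ∣ ≡ t × (∀ {j} → j ∈ₛ p → ∃ λ x → f x ≡ j)
image {zero} {n} f inj = ∅ , ∣⊥∣≡0 n , λ j∈ → contradiction j∈ ∉⊥
image {suc t} f inj with image (f ∘ suc) (Fin.suc-injective ∘ inj)
... | p , size , back with insert p (f zero) f0∉p
  where
  f0∉p : f zero ∉ₛ p
  f0∉p f0∈p = contradiction (inj (proj₂ (back f0∈p))) λ ()
... | q , size′ , back′ = q , trans size′ (cong suc size) , λ j∈ → lift (back′ j∈)
  where
  lift : ∀ {j} → j ≡ f zero ⊎ j ∈ₛ p → ∃ λ x → f x ≡ j
  lift (inj₁ eq) = zero , ≡.sym eq
  lift (inj₂ j∈) = let x , eq = back j∈ in suc x , eq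

total-uniform : ∀ {m} {K X} (L : List (Pattern m)) → All (λ c → weight c * K ≡ X) L → total L * K ≡ length L * X
total-uniform []      []         = refl
total-uniform {K = K} (c ∷ L) (eq ∷ eqs) =
  trans (*-distribʳ-+ K (weight c) (total L)) (cong₂ _+_ eq (total-uniform L eqs))

cliquePatterns : ∀ n t → List (Pattern (tri n))
cliquePatterns n t = List.map (cliquePattern true) (subsets n t) List.++ List.map (cliquePattern false) (subsets n t)

∈-cliquePatterns : ∀ {n} b (p : Subset n) → cliquePattern b p ∈ cliquePatterns n ∣ p ∣
∈-cliquePatterns true  p = ∈-++⁺ˡ (∈-map⁺ (cliquePattern true) (∈-subsets p))
∈-cliquePatterns {n} false p =
  ∈-++⁺ʳ (List.map (cliquePattern true) (subsets n ∣ p ∣)) (∈-map⁺ (cliquePattern false) (∈-subsets p))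

total-cliquePatterns : ∀ n t → total (cliquePatterns n t) * 2 ^ tri t ≤ (2 * n ^ t) * 2 ^ tri n
total-cliquePatterns n t = begin
  total (cliquePatterns n t) * 2 ^ tri t  ≡⟨ total-uniform (cliquePatterns n t) (All.++⁺ (uniform true) (uniform false)) ⟩
  length (cliquePatterns n t) * 2 ^ tri n ≤⟨ *-monoˡ-≤ (2 ^ tri n) count ⟩
  (2 * n ^ t) * 2 ^ tri n                 ∎
  where
  open ≤-Reasoning
  uniform : ∀ b → All (λ c → weight c * 2 ^ tri t ≡ 2 ^ tri n) (List.map (cliquePattern b) (subsets n t))
  uniform b = All.map⁺ (All.map (λ { {p} refl → weight-cliquePattern b p }) (subsets-size n t))
  count : length (cliquePatterns n t) ≤ 2 * n ^ t
  count = begin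
    length (cliquePatterns n t)
      ≡⟨ List.length-++ (List.map (cliquePattern true) (subsets n t)) ⟩
    length (List.map (cliquePattern true) (subsets n t)) + length (List.map (cliquePattern false) (subsets n t))
      ≡⟨ cong₂ _+_ (List.length-map _ (subsets n t)) (List.length-map _ (subsets n t)) ⟩
    length (subsets n t) + length (subsets n t)  ≤⟨ +-mono-≤ (length-subsets n t) (length-subsets n t) ⟩
    n ^ t + n ^ t                                ≡⟨ double (n ^ t) ⟩
    2 * n ^ t                                    ∎

-- Erdős's union bound: the at most `2 * n ^ t` clique patterns have total weight below `2 ^ tri n`,
-- so `avoid` finds a colouring that matches none of them.
¬Arrows : ∀ n t → 2 * n ^ t < 2 ^ tri t → ¬ Arrows n t
¬Arrows n t small arrows with avoid (tri n) (cliquePatterns n t) total<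
  where
  total< : total (cliquePatterns n t) < 2 ^ tri n
  total< = *-cancelʳ-< (2 ^ tri t) _ _ (begin-strict
    total (cliquePatterns n t) * 2 ^ tri t  ≤⟨ total-cliquePatterns n t ⟩
    (2 * n ^ t) * 2 ^ tri n                 <⟨ *-monoˡ-< (2 ^ tri n) ⦃ m^n≢0 2 (tri n) ⦄ small ⟩
    2 ^ tri t * 2 ^ tri n                   ≡⟨ *-comm (2 ^ tri t) (2 ^ tri n) ⟩
    2 ^ tri n * 2 ^ tri t                   ∎)
    where open ≤-Reasoning
... | v , ok with arrows (decode v)
... | f , inj , b , mono with image f inj
... | p , refl , back = ok (∈-cliquePatterns b p) (matches-cliquePattern b p v λ i∈p j∈p i≢j →
  let x , fx≡i = back i∈p
      y , fy≡j = back j∈p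
  in subst₂ (λ i j → cell v i j ≡ b) fx≡i fy≡j
       (mono x y λ x≡y → i≢j (trans (≡.sym fx≡i) (trans (cong f x≡y) fy≡j))))

-- With t = 4 + 2w, `suc w` is t/2 - 1. For n = 2^(t/2 - 1) the union bound asks for 1 + (t/2 - 1)t
-- < t(t - 1)/2, which holds for t > 2.
Arrows⇒> : ∀ n w → Arrows n (4 + 2 * w) → 2 ^ suc w < n
Arrows⇒> n w arrows with n ≤? 2 ^ suc w
... | no  n≰ = ≰⇒> n≰
... | yes n≤ = contradiction arrows (¬Arrows n t (begin-strict
  2 * n ^ t                  ≤⟨ *-monoʳ-≤ 2 (^-monoˡ-≤ t n≤) ⟩
  2 * (2 ^ suc w) ^ t        ≡⟨ cong (2 *_) (^-*-assoc 2 (suc w) t) ⟩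
  2 ^ suc (suc w * t)        <⟨ ^-monoʳ-< 2 ≤-refl exponent ⟩
  2 ^ tri t                  ∎))
  where
  open ≤-Reasoning
  t = 4 + 2 * w
  -- Everything is doubled to avoid halves; `2 + 2 * w`, that is t - 2, is the doubled slack.
  quadratic : ∀ w → let t = 4 + 2 * w in
    (suc (suc w * t) + suc (suc w * t) + t) + (2 + 2 * w) ≡ t * t
  quadratic = solve-∀
  exponent : suc (suc w * t) < tri t
  exponent with suc (suc w * t) <? tri t
  ... | yes lt = lt
  ... | no  ≮  = contradiction (begin-strict
    t * t                                                 ≡⟨ tri-double t ⟨
    tri t + tri t + t                                     ≤⟨ +-monoˡ-≤ t (+-mono-≤ (≮⇒≥ ≮) (≮⇒≥ ≮)) ⟩
    suc (suc w * t) + suc (suc w * t) + t                 <⟨ m<m+n _ (s≤s z≤n) ⟩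
    (suc (suc w * t) + suc (suc w * t) + t) + (2 + 2 * w) ≡⟨ quadratic w ⟩
    t * t                                                 ∎) (<-irrefl refl)

-- Existence of r(t)

least : {P : ℕ → Set} → Decidable P → ∀ n → P n → ∃ λ m → m ≤ n × P m × (∀ k → k < m → ¬ P k)
least {P} P? n Pn = search n 0 (+-identityʳ n) (λ _ ())
  where
  search : ∀ d m → d + m ≡ n → (∀ k → k < m → ¬ P k) → ∃ λ m → m ≤ n × P m × (∀ k → k < m → ¬ P k)
  search zero    m refl below = m , ≤-refl , Pn , below
  search (suc d) m eq below with P? m
  ... | yes Pm = m , subst (m ≤_) eq (m≤n+m m (suc d)) , Pm , below
  ... | no ¬Pm = search d (suc m) (trans (+-suc d m) eq) below′
    where
    below′ : ∀ k → k < suc m → ¬ P k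
    below′ k (s≤s k≤m) Pk with m≤n⇒m<n∨m≡n k≤m
    ... | inj₁ k<m  = below k k<m Pk
    ... | inj₂ refl = ¬Pm Pk

anyBool? : {P : Bool → Set} → Decidable P → Dec (∃ P)
anyBool? P? = map′ (λ { (inj₁ p) → true , p ; (inj₂ p) → false , p })
                   (λ { (true , p) → inj₁ p ; (false , p) → inj₂ p })
                   (P? true ⊎-dec P? false)

-- The codes `finToFun i` reach each function only up to pointwise equality, which `Q` therefore has
-- to respect.
anyFun? : ∀ {t n} {Q : (Fin t → Fin n) → Set} → (∀ {f g} → (∀ x → f x ≡ g x) → Q f → Q g) →
          Decidable Q → Dec (∃ Q)
anyFun? resp Q? = map′ (λ (i , q) → finToFun i , q)
                       (λ (f , q) → funToFin f , resp (λ x → ≡.sym (Fin.finToFun-funToFin f x)) q)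
                       (Fin.any? (Q? ∘ finToFun))

module _ {A : Set} (R : Bool → A → A → Set) where

  -- The relation `R` is abstract so that one decision procedure serves both `HasMonoClique` and
  -- `HasMono`.
  Mono : ∀ {t} → (Fin t → A) → Set
  Mono f = Injective _≡_ _≡_ f × ∃ λ b → ∀ x y → x ≢ y → R b (f x) (f y)

  mono-resp : ∀ {t} {f g : Fin t → A} → (∀ x → f x ≡ g x) → Mono f → Mono g
  mono-resp f≗g (inj , b , r) =
    (λ {x} {y} eq → inj (trans (f≗g x) (trans eq (≡.sym (f≗g y))))) ,
    b , λ x y x≢y → subst₂ (R b) (f≗g x) (f≗g y) (r x y x≢y)

  mono? : (∀ (u v : A) → Dec (u ≡ v)) → (∀ b u v → Dec (R b u v)) → ∀ {t} (f : Fin t → A) → Dec (Mono f)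
  mono? _≟A_ R? f =
    map′ (λ inj {x} {y} → inj x y) (λ inj x y → inj)
         (Fin.all? λ x → Fin.all? λ y → f x ≟A f y →-dec x Fin.≟ y)
    ×-dec
    anyBool? λ b → Fin.all? λ x → Fin.all? λ y → ¬? (x Fin.≟ y) →-dec R? b (f x) (f y)

hasMonoClique? : ∀ {n} t (c : Colouring n) → Dec (HasMonoClique t c)
hasMonoClique? t c = anyFun? (mono-resp R) (mono? R Fin._≟_ λ b u v → col c u v Bool.≟ b)
  where R = λ b u v → col c u v ≡ b

encode : ∀ {n} → (Fin n → Fin n → Bool) → Vec Bool (tri n)
encode {zero}  c = []
encode {suc n} c = Vec.tabulate (c zero ∘ suc) Vec.++ encode (λ i j → c (suc i) (suc j))

take-++ : ∀ {A : Set} {m n} (xs : Vec A m) (ys : Vec A n) → take m (xs Vec.++ ys) ≡ xs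
take-++ []       ys = refl
take-++ (x ∷ xs) ys = cong (x ∷_) (take-++ xs ys)

drop-++ : ∀ {A : Set} {m n} (xs : Vec A m) (ys : Vec A n) → drop m (xs Vec.++ ys) ≡ ys
drop-++ []       ys = refl
drop-++ (x ∷ xs) ys = drop-++ xs ys

cell-encode : ∀ {n} (c : Colouring n) (i j : Fin n) → i ≢ j → cell (encode (col c)) i j ≡ col c i j
cell-encode c zero zero i≢j = contradiction refl i≢j
cell-encode {suc n} c zero (suc j) _ =
  trans (cong (λ r → Vec.lookup r j) (take-++ (Vec.tabulate (col c zero ∘ suc)) _)) (Vec.lookup∘tabulate _ j)
cell-encode {suc n} c (suc i) zero _ =
  trans (trans (cong (λ r → Vec.lookup r i) (take-++ (Vec.tabulate (col c zero ∘ suc)) _)) (Vec.lookup∘tabulate _ i))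
        (Colouring.sym c zero (suc i))
cell-encode {suc n} c (suc i) (suc j) i≢j =
  trans (cong (λ r → cell r i j) (drop-++ (Vec.tabulate (col c zero ∘ suc)) _))
        (cell-encode (record { col = λ i j → col c (suc i) (suc j) ; sym = λ i j → Colouring.sym c (suc i) (suc j) })
                     i j (i≢j ∘ cong suc))

-- Colourings are functions, but a clique sees only their off-diagonal values, which a bit vector
-- records. A clique of the decoded vector is one of `c` because injectivity keeps its pairs off the
-- diagonal.
arrows? : ∀ t n → Dec (Arrows n t)
arrows? t n with anySubset? {tri n} (λ v → ¬? (hasMonoClique? t (decode {n} v)))
... | yes (v , none) = no λ arrows → none (arrows (decode v))
... | no  ¬∃         = yes arrows
  where
  arrows : Arrows n t
  arrows c with decidable-stable (hasMonoClique? t (decode (encode (col c)))) (λ none → ¬∃ (_ , none))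
  ... | f , inj , b , mono = f , inj , b , λ x y x≢y →
    trans (≡.sym (cell-encode c (f x) (f y) (x≢y ∘ inj))) (mono x y x≢y)

-- Pigeonhole and the Erdős-Szekeres upper bound

module _ {A : Set} where

  allPairs-resp-⊑ : {R : A → A → Set} {xs ys : List A} → xs ⊑ ys → AllPairs R ys → AllPairs R xs
  allPairs-resp-⊑ []            []         = []
  allPairs-resp-⊑ (_ ∷ʳ τ)      (_ ∷ rs)   = allPairs-resp-⊑ τ rs
  allPairs-resp-⊑ (refl ∷ τ)    (r ∷ rs)   = All-resp-⊆ τ r ∷ allPairs-resp-⊑ τ rs

  allPairs-lookup : {R : A → A → Set} → Symmetric R → ∀ {xs} → AllPairs R xs →
                    ∀ i j → i ≢ j → R (List.lookup xs i) (List.lookup xs j)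
  allPairs-lookup sym (r ∷ rs) zero    zero    i≢j = contradiction refl i≢j
  allPairs-lookup sym (r ∷ rs) zero    (suc j) i≢j = All.lookup r (∈-lookup j)
  allPairs-lookup sym (r ∷ rs) (suc i) zero    i≢j = sym (All.lookup r (∈-lookup i))
  allPairs-lookup sym (r ∷ rs) (suc i) (suc j) i≢j = allPairs-lookup sym rs i j (i≢j ∘ cong suc)

  -- A relation that excludes equality makes the entries distinct, so lookup at the first `t`
  -- positions is injective.
  allPairs⇒map : {R : A → A → Set} → Symmetric R → (∀ {x y} → R x y → x ≢ y) →
                 ∀ {xs t} → AllPairs R xs → t ≤ length xs →
                 ∃ λ (f : Fin t → A) → Injective _≡_ _≡_ f × (∀ x y → x ≢ y → R (f x) (f y))
  allPairs⇒map {R} sym irrefl {xs} {t} rs t≤ = f , inj , r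
    where
    f : Fin t → A
    f x = List.lookup xs (inject≤ x t≤)
    r : ∀ x y → x ≢ y → R (f x) (f y)
    r x y x≢y = allPairs-lookup sym rs _ _ (x≢y ∘ Fin.inject≤-injective t≤ t≤ x y)
    inj : Injective _≡_ _≡_ f
    inj {x} {y} eq = decidable-stable (x Fin.≟ y) λ x≢y → irrefl (r x y x≢y) eq

  -- The sharp pigeonhole principle: x + y - 1 elements suffice. The element saved is the centre of
  -- a star when `U` lists its leaves.
  split : (P : Bool → A → Set) → ∀ x y U → All (λ u → ∃ λ b → P b u) U → x + y ≤ suc (length U) →
          ∃ λ b → ∃ λ V → V ⊑ U × All (P b) V × (if b then x else y) ≤ length V
  split P zero    y       U       ps                 le = true , [] , minimum U , [] , z≤n
  split P (suc x) zero    U       ps                 le = false , [] , minimum U , [] , z≤n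
  split P (suc x) (suc y) []      ps                 (s≤s le) =
    contradiction (≤-trans (m≤n+m (suc y) x) le) λ ()
  split P (suc x) (suc y) (u ∷ U) ((true , p) ∷ ps)  (s≤s le) with split P x (suc y) U ps le
  ... | true  , V , τ , qs , big = true , u ∷ V , refl ∷ τ , p ∷ qs , s≤s big
  ... | false , V , τ , qs , big = false , V , u ∷ʳ τ , qs , big
  split P (suc x) (suc y) (u ∷ U) ((false , p) ∷ ps) (s≤s le)
    with split P (suc x) y U ps (subst (_≤ suc (length U)) (+-suc x y) le)
  ... | true  , V , τ , qs , big = true , V , u ∷ʳ τ , qs , big
  ... | false , V , τ , qs , big = false , u ∷ V , refl ∷ τ , p ∷ qs , s≤s big

  -- The Erdős-Szekeres induction: the bound halves when `i` or `j` drops by one, and one colour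
  -- class at the head `u` reaches that half.
  ramsey : (E : Bool → A → A → Set) → ∀ i j U → AllPairs (λ u v → ∃ λ b → E b u v) U → 2 ^ (i + j) ≤ length U →
           ∃ λ b → ∃ λ K → K ⊑ U × AllPairs (E b) K × (if b then i else j) ≤ length K
  ramsey E zero    j       U es big = true , [] , minimum U , [] , z≤n
  ramsey E (suc i) zero    U es big = false , [] , minimum U , [] , z≤n
  ramsey E (suc i) (suc j) [] es big = contradiction big (<⇒≱ (m^n>0 2 (suc i + suc j)))
  ramsey E (suc i) (suc j) (u ∷ U) (e ∷ es) big
    with split (λ b → E b u) (2 ^ (i + suc j)) (2 ^ (suc i + j)) U e (≤-trans (≤-reflexive halves) big)
    where
    halves : 2 ^ (i + suc j) + 2 ^ (suc i + j) ≡ 2 ^ (suc i + suc j)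
    halves = trans (cong (λ m → 2 ^ (i + suc j) + 2 ^ m) (≡.sym (+-suc i j))) (double (2 ^ (i + suc j)))
  ... | true  , V , τ , es′ , big′ with ramsey E i (suc j) V (allPairs-resp-⊑ τ es) big′
  ...   | true  , K , κ , r , large = true , u ∷ K , refl ∷ ⊑-trans κ τ , All-resp-⊆ κ es′ ∷ r , s≤s large
  ...   | false , K , κ , r , large = false , K , u ∷ʳ ⊑-trans κ τ , r , large
  ramsey E (suc i) (suc j) (u ∷ U) (e ∷ es) big
      | false , V , τ , es′ , big′ with ramsey E (suc i) j V (allPairs-resp-⊑ τ es) big′
  ...   | true  , K , κ , r , large = true , K , u ∷ʳ ⊑-trans κ τ , r , large
  ...   | false , K , κ , r , large = false , u ∷ K , refl ∷ ⊑-trans κ τ , All-resp-⊆ κ es′ ∷ r , s≤s large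

arrows-exponential : ∀ t → Arrows (2 ^ (t + t)) t
arrows-exponential t c with ramsey E t t (List.allFin (2 ^ (t + t)))
                              (AllPairs.tabulate⁺ λ i≢j → _ , i≢j , refl)
                              (≤-reflexive (≡.sym (List.length-tabulate {n = 2 ^ (t + t)} id)))
  where
  E : Bool → Fin (2 ^ (t + t)) → Fin (2 ^ (t + t)) → Set
  E b u v = u ≢ v × col c u v ≡ b
... | b , K , _ , mono , large =
  let f , inj , r = allPairs⇒map
        (λ (u≢v , eq) → u≢v ∘ ≡.sym , trans (Colouring.sym c _ _) eq) proj₁
        mono (≤-trans (size b) large)
  in f , inj , b , λ x y x≢y → proj₂ (r x y x≢y)
  where
  size : ∀ b → t ≤ (if b then t else t)
  size true  = ≤-refl
  size false = ≤-refl

ramseyNumber : ∀ t → ∃ λ n → IsRamsey t n × n ≤ 2 ^ (t + t)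
ramseyNumber t =
  let n , n≤ , arrows , below = least (arrows? t) (2 ^ (t + t)) (arrows-exponential t)
  in n , (arrows , below) , n≤

-- Decidability of the game

-- A strict bound: every vertex from `bound S` on is untouched by `S`.
bound : List CEdge → ℕ
bound []                = 0
bound ((u , v , _) ∷ S) = (suc u ⊔ suc v) ⊔ bound S

Bounded : ℕ → CEdge → Set
Bounded M (u , v , _) = u < M × v < M

bound-correct : ∀ S → All (Bounded (bound S)) S
bound-correct []                = []
bound-correct ((u , v , b) ∷ S) =
  (m≤n⇒m≤n⊔o (bound S) (m≤m⊔n (suc u) (suc v)) , m≤n⇒m≤n⊔o (bound S) (m≤n⊔m (suc u) (suc v))) ∷
  All.map (λ (u< , v<) → m≤n⇒m≤o⊔n _ u< , m≤n⇒m≤o⊔n _ v<) (bound-correct S)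

Edge : List CEdge → Bool → ℕ → ℕ → Set
Edge S b u v = ((u , v , b) ∈ S) ⊎ ((v , u , b) ∈ S)

edge? : ∀ S b u v → Dec (Edge S b u v)
edge? S b u v = ((u , v , b) ∈? S) ⊎-dec ((v , u , b) ∈? S)
  where open DecMembership (≡-dec _≟_ (≡-dec _≟_ Bool._≟_)) using (_∈?_)

joined? : ∀ u v S → Dec (Joined u v S)
joined? u v S = anyBool? λ b → edge? S b u v

other : ∀ {t} (x : Fin (2 + t)) → ∃ λ y → x ≢ y
other zero    = suc zero , λ ()
other (suc x) = zero , λ ()

-- In a clique on at least two vertices each vertex lies on an edge of `S`, hence below `bound S`,
-- so finitely many maps are to be tested. The index `2 + t` guarantees the second vertex.
hasMono? : ∀ t S → Dec (HasMono (2 + t) S)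
hasMono? t S = map′
  (λ (f , mono) → toℕ ∘ f , mono)
  (λ (f , mono) → let below = f<M f mono in
    (λ x → fromℕ< (below x)) , mono-resp (Edge S) (λ x → ≡.sym (Fin.toℕ-fromℕ< (below x))) mono)
  (anyFun? (λ f≗g → mono-resp (Edge S) (cong toℕ ∘ f≗g)) (λ f → mono? (Edge S) _≟_ (edge? S) (toℕ ∘ f)))
  where
  M = bound S
  f<M : (f : Fin (2 + t) → ℕ) → Mono (Edge S) f → ∀ x → f x < M
  f<M f (_ , b , edges) x with edges x (proj₁ (other x)) (proj₂ (other x))
  ... | inj₁ e∈S = proj₁ (All.lookup (bound-correct S) e∈S)
  ... | inj₂ e∈S = proj₂ (All.lookup (bound-correct S) e∈S)

relabel : (ℕ → ℕ) → CEdge → CEdge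
relabel π (u , v , b) = π u , π v , b

∈-relabel⁻ : ∀ {π} → Injective _≡_ _≡_ π → ∀ {u v b S} → (π u , π v , b) ∈ List.map (relabel π) S → (u , v , b) ∈ S
∈-relabel⁻ {π} inj e∈ with ∈-map⁻ (relabel π) e∈
... | (u′ , v′ , b′) , e∈S , eq
  rewrite inj (cong proj₁ eq) | inj (cong (proj₁ ∘ proj₂) eq) | cong (proj₂ ∘ proj₂) eq = e∈S

-- The whole strategy is relabelled; injectivity keeps endpoints distinct and undrawn pairs undrawn.
wins-relabel : ∀ {π} → Injective _≡_ _≡_ π → ∀ {t k S} → BuilderWins t k S → BuilderWins t k (List.map (relabel π) S)
wins-relabel {π} inj {S = S} (done (f , f-inj , b , edges)) =
  done (π ∘ f , f-inj ∘ inj , b , λ x y x≢y → push (edges x y x≢y))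
  where
  push : ∀ {u v} → Edge S b u v → Edge (List.map (relabel π) S) b (π u) (π v)
  push (inj₁ e∈S) = inj₁ (∈-map⁺ (relabel π) e∈S)
  push (inj₂ e∈S) = inj₂ (∈-map⁺ (relabel π) e∈S)
wins-relabel {π} inj {S = S} (move u v u≢v ¬joined wins) =
  move (π u) (π v) (u≢v ∘ inj) (¬joined ∘ pull) λ b → wins-relabel inj (wins b)
  where
  pull : Joined (π u) (π v) (List.map (relabel π) S) → Joined u v S
  pull (b , inj₁ e∈) = b , inj₁ (∈-relabel⁻ inj e∈)
  pull (b , inj₂ e∈) = b , inj₂ (∈-relabel⁻ inj e∈)

relabel-fixed : ∀ {π M} → (∀ {x} → x < M → π x ≡ x) → ∀ {S} → All (Bounded M) S → List.map (relabel π) S ≡ S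
relabel-fixed fix []                = refl
relabel-fixed fix ((u< , v<) ∷ bds) rewrite fix u< | fix v< = cong (_ ∷_) (relabel-fixed fix bds)

swap : ℕ → ℕ → ℕ → ℕ
swap a b x with x ≟ a | x ≟ b
... | yes _ | _     = b
... | no _  | yes _ = a
... | no _  | no _  = x

swap-involutive : ∀ a b x → swap a b (swap a b x) ≡ x
swap-involutive a b x with x ≟ a | x ≟ b
swap-involutive a b x | yes refl | _ with b ≟ x | b ≟ b
... | yes eq | _     = eq
... | no _ | yes _   = refl
... | no _ | no b≢b  = contradiction refl b≢b
swap-involutive a b x | no x≢a | yes refl with a ≟ a
... | yes _  = refl
... | no a≢a = contradiction refl a≢a
swap-involutive a b x | no x≢a | no x≢b with x ≟ a | x ≟ b
... | yes eq | _      = contradiction eq x≢a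
... | no _   | yes eq = contradiction eq x≢b
... | no _   | no _   = refl

-- A vertex from `M` on is exchanged with `M` itself, which moves nothing below `M`.
compress : ∀ M u → ∃ λ π → Injective _≡_ _≡_ π × (∀ {x} → x < M → π x ≡ x) × π u < suc M
compress M u with u <? M
... | yes u<M = id , id , (λ _ → refl) , m≤n⇒m≤1+n u<M
... | no  u≮M = swap u M , inj , fix , target
  where
  inj : Injective _≡_ _≡_ (swap u M)
  inj {x} {y} eq = trans (≡.sym (swap-involutive u M x)) (trans (cong (swap u M) eq) (swap-involutive u M y))
  fix : ∀ {x} → x < M → swap u M x ≡ x
  fix {x} x<M with x ≟ u | x ≟ M
  ... | yes refl | _        = contradiction x<M u≮M
  ... | no _     | yes refl = contradiction x<M (<-irrefl refl)
  ... | no _     | no _     = refl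
  target : swap u M u < suc M
  target with u ≟ u
  ... | yes _  = ≤-refl
  ... | no u≢u = contradiction refl u≢u

Move : ℕ → ℕ → List CEdge → ℕ → ℕ → Set
Move t k S u v = u ≢ v × ¬ Joined u v S × (∀ b → BuilderWins t k ((u , v , b) ∷ S))

-- Untouched vertices are interchangeable, so two of them suffice for the next move.
compress-move : ∀ {t k S} u v → Move t k S u v →
  ∃ λ u′ → u′ < 2 + bound S × ∃ λ v′ → v′ < 2 + bound S × Move t k S u′ v′
compress-move {t} {k} {S} u v (u≢v , ¬joined , wins)
  with compress (bound S) u
-- The raised bound makes `ρ` fix `π u` as well as the vertices of `S`.
... | π , π-inj , π-fix , πu< with compress (suc (bound S)) (π v)
... | ρ , ρ-inj , ρ-fix , ρπv< =
  ρ (π u) , subst (_< 2 + bound S) (≡.sym (ρ-fix πu<)) (m≤n⇒m≤1+n πu<) ,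
  ρ (π v) , ρπv< ,
  u≢v ∘ inj ,
  ¬joined ∘ pull ,
  λ b → subst (λ S′ → BuilderWins t k ((ρ (π u) , ρ (π v) , b) ∷ S′)) fixed (wins-relabel inj (wins b))
  where
  inj : Injective _≡_ _≡_ (ρ ∘ π)
  inj = π-inj ∘ ρ-inj
  fixed : List.map (relabel (ρ ∘ π)) S ≡ S
  fixed = relabel-fixed {ρ ∘ π} {bound S} (λ x< → trans (cong ρ (π-fix x<)) (ρ-fix (m≤n⇒m≤1+n x<))) (bound-correct S)
  pull : Joined (ρ (π u)) (ρ (π v)) S → Joined u v S
  pull (b , inj₁ e∈) = b , inj₁ (∈-relabel⁻ inj (subst (_ ∈_) (≡.sym fixed) e∈))
  pull (b , inj₂ e∈) = b , inj₂ (∈-relabel⁻ inj (subst (_ ∈_) (≡.sym fixed) e∈))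

builderWins? : ∀ t k S → Dec (BuilderWins (2 + t) k S)
builderWins? t zero    S = map′ done (λ { (done m) → m }) (hasMono? t S)
builderWins? t (suc k) S = map′
  (λ { (inj₁ m) → done m ; (inj₂ (u , _ , v , _ , u≢v , ¬joined , wins)) → move u v u≢v ¬joined wins })
  (λ { (done m) → inj₁ m ; (move u v u≢v ¬joined wins) → inj₂ (compress-move u v (u≢v , ¬joined , wins)) })
  (hasMono? t S ⊎-dec
   anyUpTo? (λ u → anyUpTo? (λ v → move? u v) (2 + bound S)) (2 + bound S))
  where
  move? : ∀ u v → Dec (Move (2 + t) k S u v)
  move? u v = ¬? (u ≟ v) ×-dec ¬? (joined? u v S) ×-dec
    map′ (λ { (red , blue) true → red ; (red , blue) false → blue }) (λ w → w true , w false)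
         (builderWins? t k ((u , v , true) ∷ S) ×-dec builderWins? t k ((u , v , false) ∷ S))

onlineRamseyNumber : ∀ {t} k → 2 ≤ t → BuilderWins t k [] → ∃ λ m → IsOnlineRamsey t m × m ≤ k
onlineRamseyNumber {suc (suc t)} k (s≤s (s≤s _)) wins =
  let m , m≤k , wins′ , below = least (λ m → builderWins? t m []) k wins
  in m , (wins′ , below) , m≤k

-- Builder's strategy

-- A position is an arbitrary list, whose type does not exclude loops; carrying `u ≢ v` lets
-- distinctness be read off adjacency.
Adj : List CEdge → Bool → ℕ → ℕ → Set
Adj S b u v = u ≢ v × Edge S b u v

adj-sym : ∀ {S b} → Symmetric (Adj S b)
adj-sym (u≢v , inj₁ e∈S) = u≢v ∘ ≡.sym , inj₂ e∈S
adj-sym (u≢v , inj₂ e∈S) = u≢v ∘ ≡.sym , inj₁ e∈S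

adj-mono : ∀ {S S′ b u v} → S ⊆ S′ → Adj S b u v → Adj S′ b u v
adj-mono S⊆S′ (u≢v , inj₁ e∈S) = u≢v , inj₁ (S⊆S′ e∈S)
adj-mono S⊆S′ (u≢v , inj₂ e∈S) = u≢v , inj₂ (S⊆S′ e∈S)

Linked : List CEdge → ℕ → ℕ → Set
Linked S u v = ∃ λ b → Adj S b u v

linked-mono : ∀ {S S′ u v} → S ⊆ S′ → Linked S u v → Linked S′ u v
linked-mono S⊆S′ (b , adj) = b , adj-mono S⊆S′ adj

wins-weaken : ∀ {t k k′ S} → k ≤ k′ → BuilderWins t k S → BuilderWins t k′ S
wins-weaken le       (done m)                   = done m
wins-weaken (s≤s le) (move u v u≢v ¬joined wins) = move u v u≢v ¬joined λ b → wins-weaken le (wins b)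

-- A joined pair may not be drawn again; its known colour is used and the round is saved.
-- Quantifying over all larger positions lets one continuation cover both cases.
draw : ∀ {t k S u v} → u ≢ v → (∀ {S′} → S ⊆ S′ → Linked S′ u v → BuilderWins t k S′) → BuilderWins t (suc k) S
draw {S = S} {u} {v} u≢v next with joined? u v S
... | yes (b , e)  = wins-weaken (n≤1+n _) (next id (b , u≢v , e))
... | no  ¬joined = move u v u≢v ¬joined λ b → next there (b , u≢v , inj₁ (here refl))

drawStar : ∀ {t k S} u V → All (u ≢_) V →
           (∀ {S′} → S ⊆ S′ → All (Linked S′ u) V → BuilderWins t k S′) → BuilderWins t (length V + k) S
drawStar u []      []            next = next id []
drawStar u (v ∷ V) (u≢v ∷ u≢V) next =
  draw u≢v λ S⊆S′ uv → drawStar u V u≢V λ S′⊆S″ uV →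
    next (S′⊆S″ ∘ S⊆S′) (linked-mono S′⊆S″ uv ∷ uV)

drawClique : ∀ {t k S} U → Unique U →
             (∀ {S′} → S ⊆ S′ → AllPairs (Linked S′) U → BuilderWins t k S′) → BuilderWins t (tri (length U) + k) S
drawClique []      []           next = next id []
drawClique {t} {k} {S} (u ∷ U) (u∉U ∷ uniq) next =
  subst (λ k → BuilderWins t k S) (≡.sym (+-assoc (length U) (tri (length U)) k))
    (drawStar u U u∉U λ S⊆S′ uU → drawClique U uniq λ S′⊆S″ UU →
      next (S′⊆S″ ∘ S⊆S′) (All.map (linked-mono S′⊆S″) uU ∷ UU))

clique-wins : ∀ {t k S b K} → AllPairs (Adj S b) K → t ≤ length K → BuilderWins t k S
clique-wins {b = b} clique large =
  let f , inj , adj = allPairs⇒map adj-sym proj₁ clique large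
  in done (f , inj , b , λ x y x≢y → proj₂ (adj x y x≢y))

-- The invariant of the strategy: `A` holds the vertices collected for colour `b`, and `U` the
-- remaining candidates. The size is a lower bound so that it can be weakened.
Attached : List CEdge → Bool → ℕ → List ℕ → Set
Attached S b x U = ∃ λ A → x ≤ length A × AllPairs (Adj S b) A × All (λ a → All (Adj S b a) U) A

attached-zero : ∀ {S b U} → Attached S b 0 U
attached-zero = [] , z≤n , [] , []

attached-weaken : ∀ {S b x y U} → x ≤ y → Attached S b y U → Attached S b x U
attached-weaken x≤y (A , large , clique , joins) = A , ≤-trans x≤y large , clique , joins

attached-resp : ∀ {S S′ b x U V} → S ⊆ S′ → V ⊑ U → Attached S b x U → Attached S′ b x V
attached-resp S⊆S′ V⊑U (A , large , clique , joins) =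
  A , large , AllPairs.map (adj-mono S⊆S′) clique ,
  All.map (λ j → All.map (adj-mono S⊆S′) (All-resp-⊆ V⊑U j)) joins

-- The new vertex `u` was itself a candidate, hence is already joined to all of `A`.
attached-extend : ∀ {S b x u U V} → V ⊑ U → All (Adj S b u) V → Attached S b x (u ∷ U) → Attached S b (suc x) V
attached-extend {u = u} V⊑U uV (A , large , clique , joins) =
  u ∷ A , s≤s large ,
  All.map (adj-sym ∘ All.head) joins ∷ clique ,
  uV ∷ All.map (All-resp-⊆ V⊑U ∘ All.tail) joins

attached-clique : ∀ {t k x y S b U K} → t ≤ x + y → Attached S b x U → AllPairs (Adj S b) K → y ≤ length K →
                  All (_∈ U) K → BuilderWins t k S
attached-clique {t} {x = x} {y} {K = K} t≤ (A , large , clique , joins) KK y≤ K⊆U =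
  clique-wins (AllPairs.++⁺ clique KK (All.map (λ j → All.map (All.lookup j) K⊆U) joins)) (begin
    t                     ≤⟨ t≤ ⟩
    x + y                 ≤⟨ +-mono-≤ large y≤ ⟩
    length A + length K   ≡⟨ List.length-++ A ⟨
    length (A List.++ K)  ∎)
  where open ≤-Reasoning

-- The Erdős–Szekeres number C(i + j, i).
es : ℕ → ℕ → ℕ
es zero    j       = 1
es (suc i) zero    = 1
es (suc i) (suc j) = es i (suc j) + es (suc i) j

es>0 : ∀ i j → 0 < es i j
es>0 zero    j       = ≤-refl
es>0 (suc i) zero    = ≤-refl
es>0 (suc i) (suc j) = ≤-trans (es>0 i (suc j)) (m≤m+n _ _)

-- With x = 16/15 and y = 16 the function x^i y^j satisfies the recursion, since 1/x + 1/y = 1.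
es-bound : ∀ i j → 15 ^ i * es i j ≤ 16 ^ (i + j)
es-bound zero    j       = ≤-trans (≤-reflexive (*-identityʳ 1)) (m^n>0 16 j)
es-bound (suc i) zero    = begin
  15 ^ suc i * 1     ≡⟨ *-identityʳ (15 ^ suc i) ⟩
  15 ^ suc i         ≤⟨ ^-monoˡ-≤ (suc i) (n≤1+n 15) ⟩
  16 ^ suc i         ≡⟨ cong (16 ^_) (+-identityʳ (suc i)) ⟨
  16 ^ (suc i + 0)   ∎
  where open ≤-Reasoning
es-bound (suc i) (suc j) = begin
  15 ^ suc i * (es i (suc j) + es (suc i) j)                  ≡⟨ expand (15 ^ i) (es i (suc j)) (es (suc i) j) ⟩
  15 * (15 ^ i * es i (suc j)) + 15 ^ suc i * es (suc i) j    ≤⟨ +-mono-≤ (*-monoʳ-≤ 15 (es-bound i (suc j))) (es-bound (suc i) j) ⟩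
  15 * 16 ^ (i + suc j) + 16 ^ (suc i + j)                    ≡⟨ cong (λ m → 15 * 16 ^ (i + suc j) + 16 ^ m) (≡.sym (+-suc i j)) ⟩
  15 * 16 ^ (i + suc j) + 16 ^ (i + suc j)                    ≡⟨ +-comm (15 * 16 ^ (i + suc j)) _ ⟩
  16 ^ (suc i + suc j)                                        ∎
  where
  open ≤-Reasoning
  expand : ∀ p x y → (15 * p) * (x + y) ≡ 15 * (p * x) + (15 * p) * y
  expand = solve-∀

byColour : ∀ {ℓ} (P : Bool → Set ℓ) c → P c → P (not c) → ∀ b → P b
byColour P true  p q true  = p
byColour P true  p q false = q
byColour P false p q true  = q
byColour P false p q false = p

-- From es i j * n vertices, Builder either collects i further vertices of colour c,
-- which completes a K_t, or j further vertices of the other colour.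
phase : ∀ {t s n N k} c i j x y {S} U → 0 < n → t ≤ x + i → s ≤ y + j →
        Unique U → es i j * n ≤ length U → length U ≤ N →
        Attached S c x U → Attached S (not c) y U →
        (∀ {S′ V} → V ⊑ U → n ≤ length V →
          Attached S′ c x V → Attached S′ (not c) s V → BuilderWins t k S′) →
        BuilderWins t ((i + j) * N + k) S
-- With `i` used up, `x` alone reaches `t`.
phase c zero j x y U 0<n t≤ s≤ uniq large small (A , x≤ , clique , _) _ next =
  clique-wins clique (≤-trans t≤ (≤-trans (≤-reflexive (+-identityʳ x)) x≤))
-- With `j` used up, `y` reaches `s`; here `es` is 1, so `n` candidates remain.
phase {n = n} {N} {k} c (suc i) zero x y U 0<n t≤ s≤ uniq large small at at′ next =
  wins-weaken (m≤n+m k ((suc i + 0) * N))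
    (next ⊆-refl (≤-trans (≤-reflexive (≡.sym (*-identityˡ n))) large) at
          (attached-weaken (≤-trans s≤ (≤-reflexive (+-identityʳ y))) at′))
phase {n = n} c (suc i) (suc j) x y [] 0<n t≤ s≤ uniq large small at at′ next =
  contradiction large (<⇒≱ (*-mono-≤ (es>0 (suc i) (suc j)) 0<n))
phase {t} {s} {n} {N} {k} c (suc i) (suc j) x y {S} (u ∷ U) 0<n t≤ s≤ (u∉U ∷ uniq) large small at at′ next =
  wins-weaken cost (drawStar u U u∉U step)
  where
  open ≤-Reasoning
  rest = (i + suc j) * N + k
  cost : length U + rest ≤ (suc i + suc j) * N + k
  cost = begin
    length U + rest                  ≤⟨ +-monoˡ-≤ rest (≤-trans (n≤1+n _) small) ⟩
    N + ((i + suc j) * N + k)        ≡⟨ +-assoc N ((i + suc j) * N) k ⟨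
    (suc i + suc j) * N + k          ∎
  shorter : ∀ {V} → V ⊑ U → length V ≤ N
  shorter τ = ≤-trans (length-mono-≤ τ) (≤-trans (n≤1+n _) small)
  step : ∀ {S′} → S ⊆ S′ → All (Linked S′ u) U → BuilderWins t rest S′
  -- Colours are taken relative to `c`: `true` stands for `c` and `false` for `not c`.
  step {S′} S⊆S′ linked with split (λ b → Adj S′ (if b then c else not c) u) (es i (suc j) * n) (es (suc i) j * n) U
         (All.map (λ {v} (b , adj) → byColour (λ b → Adj S′ b u v → ∃ λ b′ → Adj S′ (if b′ then c else not c) u v) c (true ,_) (false ,_) b adj) linked)
         (subst (_≤ suc (length U)) (*-distribʳ-+ n (es i (suc j)) (es (suc i) j)) large)
  ... | true  , V , τ , adj , big =
    phase c i (suc j) (suc x) y V 0<n (subst (t ≤_) (+-suc x i) t≤) s≤ (allPairs-resp-⊑ τ uniq) big (shorter τ)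
      (attached-extend τ adj (attached-resp S⊆S′ ⊆-refl at)) (attached-resp S⊆S′ (u ∷ʳ τ) at′)
      λ σ n≤ at₁ at₂ → next (u ∷ʳ ⊑-trans σ τ) n≤ (attached-weaken (n≤1+n x) at₁) at₂
  ... | false , V , τ , adj , big =
    subst (λ m → BuilderWins t (m * N + k) S′) (≡.sym (+-suc i j))
      (phase c (suc i) j x (suc y) V 0<n t≤ (subst (s ≤_) (+-suc y j) s≤) (allPairs-resp-⊑ τ uniq) big (shorter τ)
        (attached-resp S⊆S′ (u ∷ʳ τ) at) (attached-extend τ adj (attached-resp S⊆S′ ⊆-refl at′))
        λ σ → next (u ∷ʳ ⊑-trans σ τ))

module _ {R : Bool → ℕ → ℕ → Set} where

  -- Both orders of a pair read the one witness stored in the upper triangle, so the matrix is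
  -- symmetric even if a list holds the pair in both colours. The diagonal value is arbitrary.
  colours : ∀ {U} → AllPairs (λ u v → ∃ λ b → R b u v) U → Fin (length U) → Fin (length U) → Bool
  colours (r ∷ rs) zero    zero    = false
  colours (r ∷ rs) zero    (suc j) = proj₁ (All.lookup r (∈-lookup j))
  colours (r ∷ rs) (suc i) zero    = proj₁ (All.lookup r (∈-lookup i))
  colours (r ∷ rs) (suc i) (suc j) = colours rs i j

  colours-sym : ∀ {U} (rs : AllPairs (λ u v → ∃ λ b → R b u v) U) i j → colours rs i j ≡ colours rs j i
  colours-sym (r ∷ rs) zero    zero    = refl
  colours-sym (r ∷ rs) zero    (suc j) = refl
  colours-sym (r ∷ rs) (suc i) zero    = refl
  colours-sym (r ∷ rs) (suc i) (suc j) = colours-sym rs i j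

  colours-correct : (∀ {b} → Symmetric (R b)) → ∀ {U} (rs : AllPairs (λ u v → ∃ λ b → R b u v) U) i j → i ≢ j →
                    R (colours rs i j) (List.lookup U i) (List.lookup U j)
  colours-correct sym (r ∷ rs) zero    zero    i≢j = contradiction refl i≢j
  colours-correct sym (r ∷ rs) zero    (suc j) i≢j = proj₂ (All.lookup r (∈-lookup j))
  colours-correct sym (r ∷ rs) (suc i) zero    i≢j = sym (proj₂ (All.lookup r (∈-lookup i)))
  colours-correct sym (r ∷ rs) (suc i) (suc j) i≢j = colours-correct sym rs i j (i≢j ∘ cong suc)

arrows-clique : ∀ {k S} U → Arrows (length U) k → AllPairs (Linked S) U →
                ∃ λ b → ∃ λ K → AllPairs (Adj S b) K × k ≤ length K × All (_∈ U) K
arrows-clique {S = S} U arrows linked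
  with arrows (record { col = colours linked ; sym = colours-sym linked })
... | f , inj , b , mono =
  b , List.tabulate (List.lookup U ∘ f) ,
  AllPairs.tabulate⁺ (λ {x} {y} x≢y → subst (λ b → Adj S b _ _) (mono x y x≢y)
    (colours-correct adj-sym linked (f x) (f y) (x≢y ∘ inj))) ,
  ≤-reflexive (≡.sym (List.length-tabulate _)) ,
  All.tabulate⁺ (λ x → ∈-lookup (f x))

-- Joining `n` candidates completely forces a monochromatic K_k. Painter decides its colour, but `s`
-- vertices are attached in either colour and complete it to a K_t.
finish : ∀ {t s k n S U} → t ≤ s + k → Arrows n k → Unique U → n ≤ length U →
         (∀ b → Attached S b s U) → BuilderWins t (tri n + 0) S
finish {t} {s} {k} {n} {S} {U} t≤ arrows uniq n≤ at =
  subst (λ m → BuilderWins t (tri m + 0) S) size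
    (drawClique V (allPairs-resp-⊑ V⊑U uniq) λ S⊆S′ linked →
      let b , K , clique , large , K⊆V = arrows-clique V (subst (λ m → Arrows m k) (≡.sym size) arrows) linked
      in attached-clique t≤ (attached-resp S⊆S′ V⊑U (at b)) clique large K⊆V)
  where
  V = List.take n U
  V⊑U : V ⊑ U
  V⊑U = take-⊆ n U
  size : length V ≡ n
  size = trans (List.length-take n U) (m≤n⇒m⊓n≡m n≤)

-- Each run may shrink the candidates by the factor `es t s`, whence the initial `N`, and draws at
-- most t + s stars of at most `N` edges each.
builder-bound : ∀ t s k n → 0 < n → t ≤ s + k → Arrows n k →
  let N = es t s * (es t s * n) in
  BuilderWins t ((t + s) * N + ((t + s) * N + (tri n + 0))) []
builder-bound t s k n 0<n t≤ arrows =
  phase true t s 0 0 U (*-mono-≤ (es>0 t s) 0<n) ≤-refl ≤-refl (upTo⁺ N) (≤-reflexive (≡.sym len)) (≤-reflexive len)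
    attached-zero attached-zero λ {_} {V} V⊑U n≤ _ blue →
  -- The `s` blue vertices of the first run start the blue collection. Allowing `t` further ones
  -- keeps the factor `es t s` of the first run.
  phase false t s s 0 V 0<n (m≤n+m t s) ≤-refl (allPairs-resp-⊑ V⊑U (upTo⁺ N)) n≤
    (≤-trans (length-mono-≤ V⊑U) (≤-reflexive len)) blue attached-zero λ W⊑V n≤W blue′ red →
  finish t≤ arrows (allPairs-resp-⊑ (⊑-trans W⊑V V⊑U) (upTo⁺ N)) n≤W λ { true → red ; false → blue′ }
  where
  N = es t s * (es t s * n)
  U = upTo N
  len : length U ≡ N
  len = List.length-upTo N

-- Growth of r and cost estimates

-- Either some step is a jump by the factor `g`, or the bounds for the single steps multiply.
growth : ∀ (f : ℕ → ℕ) g a n →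
         (∃ λ j → a ≤ j × j < a + n × g * f j ≤ f (suc j)) ⊎ f (a + n) ≤ g ^ n * f a
growth f g a zero    = inj₂ (≤-reflexive (trans (cong f (+-identityʳ a)) (≡.sym (*-identityˡ (f a)))))
growth f g a (suc n) with growth f g a n | ≤-total (g * f (a + n)) (f (suc (a + n)))
... | inj₁ (j , a≤j , j< , gap) | _ = inj₁ (j , a≤j , ≤-trans j< (+-monoʳ-≤ a (n≤1+n n)) , gap)
... | inj₂ _  | inj₁ gap = inj₁ (a + n , m≤m+n a n , +-monoʳ-< a ≤-refl , gap)
... | inj₂ le | inj₂ ge  = inj₂ (begin
  f (a + suc n)       ≡⟨ cong f (+-suc a n) ⟩
  f (suc (a + n))     ≤⟨ ge ⟩
  g * f (a + n)       ≤⟨ *-monoʳ-≤ g le ⟩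
  g * (g ^ n * f a)   ≡⟨ *-assoc g (g ^ n) (f a) ⟨
  g ^ suc n * f a     ∎)
  where open ≤-Reasoning

Arrows⇒4^ : ∀ {n} τ → Arrows n (4 * suc τ) → 4 ^ suc τ < 2 * n
Arrows⇒4^ {n} τ arrows = begin-strict
  4 ^ suc τ              ≡⟨ ^-*-assoc 2 2 (suc τ) ⟩
  2 ^ (2 * suc τ)        ≡⟨ cong (2 ^_) (exponent τ) ⟩
  2 * 2 ^ suc (2 * τ)    <⟨ *-monoʳ-< 2 (Arrows⇒> n (2 * τ) (subst (Arrows n) (size τ) arrows)) ⟩
  2 * n                  ∎
  where
  open ≤-Reasoning
  exponent : ∀ τ → 2 * suc τ ≡ suc (suc (2 * τ))
  exponent = solve-∀
  size : ∀ τ → 4 * suc τ ≡ 4 + 2 * (2 * τ)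
  size = solve-∀

opaque
  -- Opaque, so that type checking never unfolds the exhaustive search behind `ramseyNumber`.
  r : ℕ → ℕ
  r t = proj₁ (ramseyNumber t)

  r-isRamsey : ∀ t → IsRamsey t (r t)
  r-isRamsey t = proj₁ (proj₂ (ramseyNumber t))

  r-upper : ∀ t → r t ≤ 2 ^ (t + t)
  r-upper t = proj₂ (proj₂ (ramseyNumber t))

r-lower : ∀ τ → 0 < τ → 4 ^ τ < 2 * r (4 * τ)
r-lower (suc τ) _ = Arrows⇒4^ τ (proj₁ (r-isRamsey (4 * suc τ)))

-- Otherwise r would grow too slowly from r(4 σ a) ≤ 2^(8 σ a) to r(4 σ (a + n)) ≥ 2^(2 σ (a + n) - 1).
gap : ∀ σ a n → 0 < σ → 0 < a + n → suc (n + (4 * a + 4 * a)) ≤ 2 * (a + n) →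
      ∃ λ j → a ≤ j × j < a + n × 2 ^ σ * r (4 * (σ * j)) ≤ r (4 * (σ * suc j))
gap σ a n 0<σ 0<a+n rates with growth (λ j → r (4 * (σ * j))) (2 ^ σ) a n
... | inj₁ found = found
... | inj₂ slow  = contradiction (begin-strict
  2 ^ (2 * (σ * (a + n)))                  ≡⟨ ^-*-assoc 2 2 (σ * (a + n)) ⟨
  4 ^ (σ * (a + n))                        <⟨ r-lower (σ * (a + n)) (*-mono-≤ 0<σ 0<a+n) ⟩
  2 * r (4 * (σ * (a + n)))                ≤⟨ *-monoʳ-≤ 2 slow ⟩
  2 * ((2 ^ σ) ^ n * r (4 * (σ * a)))      ≤⟨ *-monoʳ-≤ 2 (*-monoʳ-≤ ((2 ^ σ) ^ n) (r-upper (4 * (σ * a)))) ⟩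
  2 * ((2 ^ σ) ^ n * 2 ^ d)                ≡⟨ cong (λ m → 2 * (m * 2 ^ d)) (^-*-assoc 2 σ n) ⟩
  2 * (2 ^ (σ * n) * 2 ^ d)                ≡⟨ cong (2 *_) (^-distribˡ-+-* 2 (σ * n) d) ⟨
  -- The leading factor 2 is charged to one extra σ in the exponent, the `suc` in `rates`.
  2 ^ suc (σ * n + d)                      ≤⟨ ^-monoʳ-≤ 2 (+-monoˡ-≤ (σ * n + d) 0<σ) ⟩
  2 ^ (σ + (σ * n + d))                    ≤⟨ ^-monoʳ-≤ 2 exponent ⟩
  2 ^ (2 * (σ * (a + n)))                  ∎) (<-irrefl refl)
  where
  open ≤-Reasoning
  d = 4 * (σ * a) + 4 * (σ * a)
  collect : ∀ σ a n → σ + (σ * n + (4 * (σ * a) + 4 * (σ * a))) ≡ σ * suc (n + (4 * a + 4 * a))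
  collect = solve-∀
  regroup : ∀ σ m → σ * (2 * m) ≡ 2 * (σ * m)
  regroup = solve-∀
  exponent : σ + (σ * n + d) ≤ 2 * (σ * (a + n))
  exponent = begin
    σ + (σ * n + d)                  ≡⟨ collect σ a n ⟩
    σ * suc (n + (4 * a + 4 * a))    ≤⟨ *-monoʳ-≤ σ rates ⟩
    σ * (2 * (a + n))                ≡⟨ regroup σ (a + n) ⟩
    2 * (σ * (a + n))                ∎

-- Exponential inequalities

^-distrib-* : ∀ a b n → (a * b) ^ n ≡ a ^ n * b ^ n
^-distrib-* a b zero    = refl
^-distrib-* a b (suc n) = trans (cong (a * b *_) (^-distrib-* a b n)) ([m*n]*[o*p]≡[m*o]*[n*p] a b (a ^ n) (b ^ n))

-- This is (b/a)^m ≤ (b/a)^n with denominators cleared.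
^-ratio-mono : ∀ {a b} → a ≤ b → ∀ {m n} → m ≤ n → b ^ m * a ^ n ≤ b ^ n * a ^ m
^-ratio-mono {a} {b} a≤b {m} {n} m≤n = subst (λ n → b ^ m * a ^ n ≤ b ^ n * a ^ m) (m+[n∸m]≡n m≤n) (begin
  b ^ m * a ^ (m + d)       ≡⟨ cong (b ^ m *_) (^-distribˡ-+-* a m d) ⟩
  b ^ m * (a ^ m * a ^ d)   ≤⟨ *-monoʳ-≤ (b ^ m) (*-monoʳ-≤ (a ^ m) (^-monoˡ-≤ d a≤b)) ⟩
  b ^ m * (a ^ m * b ^ d)   ≡⟨ swap′ (b ^ m) (a ^ m) (b ^ d) ⟩
  b ^ m * b ^ d * a ^ m     ≡⟨ cong (_* a ^ m) (^-distribˡ-+-* b m d) ⟨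
  b ^ (m + d) * a ^ m       ∎)
  where
  open ≤-Reasoning
  d = n ∸ m
  swap′ : ∀ x y z → x * (y * z) ≡ x * z * y
  swap′ = solve-∀

4·3^≤4^ : ∀ d → 4 * 3 ^ (5 + d) ≤ 4 ^ (5 + d)
4·3^≤4^ zero    = ≤ᵇ⇒≤ (4 * 3 ^ 5) (4 ^ 5) _
4·3^≤4^ (suc d) = begin
  4 * (3 * 3 ^ (5 + d))   ≡⟨ swap′ 4 3 (3 ^ (5 + d)) ⟩
  3 * (4 * 3 ^ (5 + d))   ≤⟨ *-mono-≤ (n≤1+n 3) (4·3^≤4^ d) ⟩
  4 * 4 ^ (5 + d)         ∎
  where
  open ≤-Reasoning
  swap′ : ∀ x y z → x * (y * z) ≡ y * (x * z)
  swap′ = solve-∀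

ratio-power : ∀ {a b c} d σ → b ^ d ≤ c * a ^ d → b ^ (d * σ) ≤ c ^ σ * a ^ (d * σ)
ratio-power {a} {b} {c} d σ le = begin
  b ^ (d * σ)            ≡⟨ ^-*-assoc b d σ ⟨
  (b ^ d) ^ σ            ≤⟨ ^-monoˡ-≤ σ le ⟩
  (c * a ^ d) ^ σ        ≡⟨ ^-distrib-* c (a ^ d) σ ⟩
  c ^ σ * (a ^ d) ^ σ    ≡⟨ cong (c ^ σ *_) (^-*-assoc a d σ) ⟩
  c ^ σ * a ^ (d * σ)    ∎
  where open ≤-Reasoning

-- The chain is (b/a)^t ≤ (b/a)^(dσ) ≤ 3^σ ≤ 4^σ / 4; the room between 3 and 4 pays for the factor
-- 4.
4·ratio≤4^ : ∀ {a b} ⦃ _ : NonZero a ⦄ d σ t → a ≤ b → b ^ d ≤ 3 * a ^ d → 5 ≤ σ → t ≤ d * σ →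
             4 * b ^ t ≤ a ^ t * 4 ^ σ
4·ratio≤4^ {a} {b} d σ t a≤b rate 5≤σ t≤ = *-cancelʳ-≤ _ _ (a ^ u) ⦃ m^n≢0 a u ⦄ (begin
  4 * b ^ t * a ^ u            ≡⟨ *-assoc 4 (b ^ t) (a ^ u) ⟩
  4 * (b ^ t * a ^ u)          ≤⟨ *-monoʳ-≤ 4 (^-ratio-mono a≤b t≤) ⟩
  4 * (b ^ u * a ^ t)          ≤⟨ *-monoʳ-≤ 4 (*-monoˡ-≤ (a ^ t) (ratio-power d σ rate)) ⟩
  4 * (3 ^ σ * a ^ u * a ^ t)  ≡⟨ regroup 4 (3 ^ σ) (a ^ u) (a ^ t) ⟩
  a ^ t * (4 * 3 ^ σ) * a ^ u  ≤⟨ *-monoˡ-≤ (a ^ u) (*-monoʳ-≤ (a ^ t) dominated) ⟩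
  a ^ t * 4 ^ σ * a ^ u        ∎)
  where
  open ≤-Reasoning
  u = d * σ
  regroup : ∀ w x y z → w * (x * y * z) ≡ z * (w * x) * y
  regroup = solve-∀
  dominated : 4 * 3 ^ σ ≤ 4 ^ σ
  dominated = subst (λ σ → 4 * 3 ^ σ ≤ 4 ^ σ) (m+[n∸m]≡n 5≤σ) (4·3^≤4^ (σ ∸ 5))

-- From n to n + 1 the left side grows by the factor 7(n + 1)/n, which is at most 8 once n ≥ 7.
linear·7^≤8^ : ∀ c n d → 7 ≤ n → c * n * 7 ^ n ≤ 8 ^ n → c * (d + n) * 7 ^ (d + n) ≤ 8 ^ (d + n)
linear·7^≤8^ c n zero    7≤n base = base
linear·7^≤8^ c n (suc d) 7≤n base = begin
  c * suc m * (7 * x)           ≡⟨ expand c m x ⟩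
  7 * (c * m * x) + c * x * 7   ≤⟨ +-monoʳ-≤ (7 * (c * m * x)) (*-monoʳ-≤ (c * x) (≤-trans 7≤n (m≤n+m n d))) ⟩
  7 * (c * m * x) + c * x * m   ≡⟨ collect c m x ⟩
  8 * (c * m * x)               ≤⟨ *-monoʳ-≤ 8 (linear·7^≤8^ c n d 7≤n base) ⟩
  8 * 8 ^ m                     ∎
  where
  open ≤-Reasoning
  m = d + n
  x = 7 ^ m
  expand : ∀ c n x → c * suc n * (7 * x) ≡ 7 * (c * n * x) + c * x * 7
  expand = solve-∀
  collect : ∀ c n x → 7 * (c * n * x) + c * x * n ≡ 8 * (c * n * x)
  collect = solve-∀

256n·7^n≤8^n : ∀ {n} → 100 ≤ n → 256 * n * 7 ^ n ≤ 8 ^ n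
256n·7^n≤8^n {n} 100≤n = subst (λ n → 256 * n * 7 ^ n ≤ 8 ^ n) (m∸n+n≡m 100≤n)
  (linear·7^≤8^ 256 100 (n ∸ 100) (≤ᵇ⇒≤ 7 100 _) (≤ᵇ⇒≤ (256 * 100 * 7 ^ 100) (8 ^ 100) _))

-- Divided by B^τ, the left side is at most 256τ (7/2)^τ, and 256τ ≤ (8/7)^τ.
linear-absorbed : ∀ {A B} τ → 100 ≤ τ → 4 * A ≤ 7 * B → A ^ τ * (256 * τ) * 2 ^ τ ≤ B ^ τ * 4 ^ τ
linear-absorbed {A} {B} τ 100≤τ le = *-cancelʳ-≤ _ _ (4 ^ τ) ⦃ m^n≢0 4 τ ⦄ (begin
  A ^ τ * l * 2 ^ τ * 4 ^ τ         ≡⟨ regroup₁ (A ^ τ) l (2 ^ τ) (4 ^ τ) ⟩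
  (4 ^ τ * A ^ τ) * (l * 2 ^ τ)     ≡⟨ cong (_* (l * 2 ^ τ)) (^-distrib-* 4 A τ) ⟨
  (4 * A) ^ τ * (l * 2 ^ τ)         ≤⟨ *-monoˡ-≤ (l * 2 ^ τ) (^-monoˡ-≤ τ le) ⟩
  (7 * B) ^ τ * (l * 2 ^ τ)         ≡⟨ cong (_* (l * 2 ^ τ)) (^-distrib-* 7 B τ) ⟩
  (7 ^ τ * B ^ τ) * (l * 2 ^ τ)     ≡⟨ regroup₂ (7 ^ τ) (B ^ τ) l (2 ^ τ) ⟩
  (l * 7 ^ τ) * (B ^ τ * 2 ^ τ)     ≤⟨ *-monoˡ-≤ (B ^ τ * 2 ^ τ) (256n·7^n≤8^n 100≤τ) ⟩
  8 ^ τ * (B ^ τ * 2 ^ τ)           ≡⟨ cong (_* (B ^ τ * 2 ^ τ)) (^-distrib-* 2 4 τ) ⟩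
  (2 ^ τ * 4 ^ τ) * (B ^ τ * 2 ^ τ) ≡⟨ regroup₃ (2 ^ τ) (4 ^ τ) (B ^ τ) ⟩
  B ^ τ * (2 ^ τ * 2 ^ τ) * 4 ^ τ   ≡⟨ cong (λ x → B ^ τ * x * 4 ^ τ) (^-distrib-* 2 2 τ) ⟨
  B ^ τ * 4 ^ τ * 4 ^ τ             ∎)
  where
  open ≤-Reasoning
  l = 256 * τ
  regroup₁ : ∀ a l x y → a * l * x * y ≡ (y * a) * (l * x)
  regroup₁ = solve-∀
  regroup₂ : ∀ a b l x → (a * b) * (l * x) ≡ (l * a) * (b * x)
  regroup₂ = solve-∀
  regroup₃ : ∀ x y b → (x * y) * (b * x) ≡ b * (x * x) * y
  regroup₃ = solve-∀

-- This prices the two runs with `es t s` replaced by 16^(t + s) / 15^t. Its square contributes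
-- (256/225)^t, which together with (p/q)^t stays within (7/4)^τ, and 256^s, which is at most 2^τ
-- because 32σ ≤ τ.
string-cost : ∀ {p q} σ τ → 100 ≤ τ → 32 * σ ≤ τ → 4 * (p * (16 * 16)) ^ 4 ≤ 7 * (q * (15 * 15)) ^ 4 →
  let t = 4 * τ ; s = 4 * σ in
  p ^ t * (32 * (t + s)) * (16 ^ (t + s) * 16 ^ (t + s)) ≤ q ^ t * (15 ^ t * 15 ^ t) * 4 ^ τ
string-cost {p} {q} σ τ 100≤τ 32σ≤τ rate = begin
  p ^ t * (32 * (t + s)) * (16 ^ (t + s) * 16 ^ (t + s))
    ≡⟨ cong (p ^ t * (32 * (t + s)) *_) (trans (≡.sym (^-distrib-* 16 16 (t + s))) (^-distribˡ-+-* (16 * 16) t s)) ⟩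
  p ^ t * (32 * (t + s)) * ((16 * 16) ^ t * (16 * 16) ^ s)
    ≤⟨ *-mono-≤ (*-monoʳ-≤ (p ^ t) linear) (*-monoʳ-≤ ((16 * 16) ^ t) power) ⟩
  p ^ t * (256 * τ) * ((16 * 16) ^ t * 2 ^ τ)
    ≡⟨ regroup (p ^ t) (256 * τ) ((16 * 16) ^ t) (2 ^ τ) ⟩
  (p ^ t * (16 * 16) ^ t) * (256 * τ) * 2 ^ τ
    ≡⟨ cong (λ x → x * (256 * τ) * 2 ^ τ) (fourth p (16 * 16)) ⟩
  ((p * (16 * 16)) ^ 4) ^ τ * (256 * τ) * 2 ^ τ
    ≤⟨ linear-absorbed τ 100≤τ rate ⟩
  ((q * (15 * 15)) ^ 4) ^ τ * 4 ^ τ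
    ≡⟨ cong (_* 4 ^ τ) (fourth q (15 * 15)) ⟨
  q ^ t * (15 * 15) ^ t * 4 ^ τ
    ≡⟨ cong (λ x → q ^ t * x * 4 ^ τ) (^-distrib-* 15 15 t) ⟩
  q ^ t * (15 ^ t * 15 ^ t) * 4 ^ τ ∎
  where
  open ≤-Reasoning
  t = 4 * τ
  s = 4 * σ
  regroup : ∀ a l x y → a * l * (x * y) ≡ (a * x) * l * y
  regroup = solve-∀
  fourth : ∀ a b → a ^ t * b ^ t ≡ ((a * b) ^ 4) ^ τ
  fourth a b = trans (≡.sym (^-distrib-* a b t)) (≡.sym (^-*-assoc (a * b) 4 τ))
  σ≤τ : σ ≤ τ
  σ≤τ = ≤-trans (m≤n*m σ 32) 32σ≤τ
  linear : 32 * (t + s) ≤ 256 * τ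
  linear = begin
    32 * (4 * τ + 4 * σ)  ≤⟨ *-monoʳ-≤ 32 (+-monoʳ-≤ (4 * τ) (*-monoʳ-≤ 4 σ≤τ)) ⟩
    32 * (4 * τ + 4 * τ)  ≡⟨ cong (32 *_) (*-distribʳ-+ τ 4 4) ⟨
    32 * (8 * τ)          ≡⟨ *-assoc 32 8 τ ⟨
    256 * τ               ∎
  power : (16 * 16) ^ s ≤ 2 ^ τ
  power = begin
    (2 ^ 8) ^ (4 * σ)  ≡⟨ ^-*-assoc 2 8 (4 * σ) ⟩
    2 ^ (8 * (4 * σ))  ≡⟨ cong (2 ^_) (*-assoc 8 4 σ) ⟨
    2 ^ (32 * σ)       ≤⟨ ^-monoʳ-≤ 2 32σ≤τ ⟩
    2 ^ τ              ∎

-- Meant for H = 15^t, J = 16^(t + s) and X = 4^τ: the bounds on `es` and on r(t) are put in and H²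
-- is cancelled.
cancel-strings : ∀ {P Q T e H J X R} ⦃ _ : NonZero H ⦄ →
  H * e ≤ J → X ≤ 2 * R → P * (32 * T) * (J * J) ≤ Q * (H * H) * X → P * (16 * T) * (e * e) ≤ Q * R
cancel-strings {P} {Q} {T} {e} {H} {J} {X} {R} He≤J X≤ le = *-cancelʳ-≤ _ _ (2 * (H * H)) ⦃ m*n≢0 2 (H * H) ⦃ _ ⦄ ⦃ m*n≢0 H H ⦄ ⦄ (begin
  P * (16 * T) * (e * e) * (2 * (H * H))   ≡⟨ regroup₁ P T e H ⟩
  P * (32 * T) * ((H * e) * (H * e))       ≤⟨ *-monoʳ-≤ (P * (32 * T)) (*-mono-≤ He≤J He≤J) ⟩
  P * (32 * T) * (J * J)                   ≤⟨ le ⟩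
  Q * (H * H) * X                          ≤⟨ *-monoʳ-≤ (Q * (H * H)) X≤ ⟩
  Q * (H * H) * (2 * R)                    ≡⟨ regroup₂ Q H R ⟩
  Q * R * (2 * (H * H))                    ∎)
  where
  open ≤-Reasoning
  regroup₁ : ∀ P T e H → P * (16 * T) * (e * e) * (2 * (H * H)) ≡ P * (32 * T) * ((H * e) * (H * e))
  regroup₁ = solve-∀
  regroup₂ : ∀ Q H R → Q * (H * H) * (2 * R) ≡ Q * R * (2 * (H * H))
  regroup₂ = solve-∀

-- Total cost compared with C(r(t), 2)

2·square≤8·tri : ∀ R → 2 ≤ R → 2 * (R * R) ≤ 8 * tri R
2·square≤8·tri R 2≤R = +-cancelʳ-≤ (4 * R) _ _ (begin
  2 * (R * R) + 4 * R               ≡⟨ cong (2 * (R * R) +_) (*-assoc 2 2 R) ⟩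
  2 * (R * R) + 2 * (2 * R)         ≤⟨ +-monoʳ-≤ (2 * (R * R)) (*-monoʳ-≤ 2 (*-monoˡ-≤ R 2≤R)) ⟩
  2 * (R * R) + 2 * (R * R)         ≡⟨ cong (λ x → 2 * x + 2 * x) (tri-double R) ⟨
  2 * (tri R + tri R + R) + 2 * (tri R + tri R + R)  ≡⟨ regroup (tri R) R ⟩
  8 * tri R + 4 * R                 ∎)
  where
  open ≤-Reasoning
  regroup : ∀ x R → 2 * (x + x + R) + 2 * (x + x + R) ≡ 8 * x + 4 * R
  regroup = solve-∀

-- After multiplication by 8P, the two runs together and the last stage each cost at most QR², and
-- R² ≤ 4 `tri R` for R ≥ 2.
total-cost : ∀ {P Q T e R₀ R g m} →
  P * (16 * T) * (e * e) ≤ Q * R → 4 * P ≤ Q * (g * g) → g * R₀ ≤ R → R₀ ≤ R → 2 ≤ R →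
  m ≤ T * (e * (e * R₀)) + (T * (e * (e * R₀)) + (tri R₀ + 0)) →
  P * m ≤ Q * tri R
total-cost {P} {Q} {T} {e} {R₀} {R} {g} {m} strings ratio gR₀≤R R₀≤R 2≤R m≤ = *-cancelˡ-≤ 8 (begin
  8 * (P * m)
    ≤⟨ *-monoʳ-≤ 8 (*-monoʳ-≤ P m≤) ⟩
  8 * (P * (T * (e * (e * R₀)) + (T * (e * (e * R₀)) + (tri R₀ + 0))))
    ≡⟨ regroup₁ P T e R₀ (tri R₀) ⟩
  P * (16 * T) * (e * e) * R₀ + 4 * P * (tri R₀ + tri R₀)
    ≤⟨ +-mono-≤ (*-mono-≤ strings R₀≤R) (*-mono-≤ ratio (≤-trans (m≤m+n _ R₀) (≤-reflexive (tri-double R₀)))) ⟩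
  Q * R * R + Q * (g * g) * (R₀ * R₀)
    ≡⟨ regroup₂ Q R g R₀ ⟩
  Q * (R * R) + Q * ((g * R₀) * (g * R₀))
    ≤⟨ +-monoʳ-≤ (Q * (R * R)) (*-monoʳ-≤ Q (*-mono-≤ gR₀≤R gR₀≤R)) ⟩
  Q * (R * R) + Q * (R * R)
    ≡⟨ regroup₃ Q (R * R) ⟩
  Q * (2 * (R * R))
    ≤⟨ *-monoʳ-≤ Q (2·square≤8·tri R 2≤R) ⟩
  Q * (8 * tri R)
    ≡⟨ regroup₄ Q (tri R) ⟩
  8 * (Q * tri R) ∎)
  where
  open ≤-Reasoning
  regroup₁ : ∀ P T e R x → 8 * (P * (T * (e * (e * R)) + (T * (e * (e * R)) + (x + 0)))) ≡
                           P * (16 * T) * (e * e) * R + 4 * P * (x + x)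
  regroup₁ = solve-∀
  regroup₂ : ∀ Q R g x → Q * R * R + Q * (g * g) * (x * x) ≡ Q * (R * R) + Q * ((g * x) * (g * x))
  regroup₂ = solve-∀
  regroup₃ : ∀ Q x → Q * x + Q * x ≡ Q * (2 * x)
  regroup₃ = solve-∀
  regroup₄ : ∀ Q x → Q * (8 * x) ≡ 8 * (Q * x)
  regroup₄ = solve-∀

-- The lower limit on `j` makes s = 4σ a small fraction of t, so the runs are cheap; the upper limit
-- gives t ≤ 1024σ, so the gain 4^σ of the last stage outweighs 1.001^t.
online-gap : ∀ σ j → 100 ≤ σ → 32 ≤ j → j < 256 → 2 ^ σ * r (4 * (σ * j)) ≤ r (4 * (σ * suc j)) →
  let t = 4 * (σ * suc j) in ∃ λ m → IsOnlineRamsey t m × 1001 ^ t * m ≤ 1000 ^ t * (r t C 2)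
online-gap σ j 100≤σ 32≤j j<256 gR₀≤R =
  m , online , ≤-trans
    (total-cost {1001 ^ t} {1000 ^ t} {t + s} {es t s} {R₀} {R} {2 ^ σ} strings ratio gR₀≤R R₀≤R 2≤R m≤)
    (≤-reflexive (cong (1000 ^ t *_) (tri≡nC2 R)))
  where
  open ≤-Reasoning
  τ = σ * suc j
  t = 4 * τ
  s = 4 * σ
  k = 4 * (σ * j)
  R = r t
  R₀ = r k
  0<σ : 0 < σ
  0<σ = ≤-trans (s≤s z≤n) 100≤σ
  σ≤τ : σ ≤ τ
  σ≤τ = m≤m*n σ (suc j)
  0<τ : 0 < τ
  0<τ = ≤-trans 0<σ σ≤τ
  32σ≤τ : 32 * σ ≤ τ
  32σ≤τ = begin
    32 * σ    ≡⟨ *-comm 32 σ ⟩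
    σ * 32    ≤⟨ *-monoʳ-≤ σ (m≤n⇒m≤1+n 32≤j) ⟩
    σ * suc j ∎
  t≤1024σ : t ≤ 1024 * σ
  t≤1024σ = begin
    4 * (σ * suc j)  ≤⟨ *-monoʳ-≤ 4 (*-monoʳ-≤ σ j<256) ⟩
    4 * (σ * 256)    ≡⟨ cong (4 *_) (*-comm σ 256) ⟩
    4 * (256 * σ)    ≡⟨ *-assoc 4 256 σ ⟨
    1024 * σ         ∎
  t≤s+k : t ≤ s + k
  t≤s+k = ≤-reflexive (trans (cong (4 *_) (*-suc σ j)) (*-distribˡ-+ 4 σ (σ * j)))
  0<R₀ : 0 < R₀
  0<R₀ = *-cancelˡ-< 2 0 R₀ (≤-<-trans z≤n (r-lower (σ * j) (*-mono-≤ 0<σ (≤-trans (s≤s z≤n) 32≤j))))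
  R₀≤R : R₀ ≤ R
  R₀≤R = ≤-trans (m≤n*m R₀ (2 ^ σ) ⦃ m^n≢0 2 σ ⦄) gR₀≤R
  2≤R : 2 ≤ R
  2≤R = <⇒≤ (*-cancelˡ-< 2 2 R (≤-<-trans (^-monoʳ-≤ 4 0<τ) (r-lower τ 0<τ)))
  2≤t : 2 ≤ t
  2≤t = *-mono-≤ (≤ᵇ⇒≤ 2 4 _) 0<τ
  found = onlineRamseyNumber _ 2≤t (builder-bound t s k R₀ 0<R₀ t≤s+k (proj₁ (r-isRamsey k)))
  m = proj₁ found
  online : IsOnlineRamsey t m
  online = proj₁ (proj₂ found)
  m≤ = proj₂ (proj₂ found)
  strings : 1001 ^ t * (16 * (t + s)) * (es t s * es t s) ≤ 1000 ^ t * R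
  strings = cancel-strings {1001 ^ t} {1000 ^ t} {t + s} {es t s} {15 ^ t} {16 ^ (t + s)} {4 ^ τ} {R} ⦃ m^n≢0 15 t ⦄
     (es-bound t s) (<⇒≤ (r-lower τ 0<τ))
    (string-cost {1001} {1000} σ τ (≤-trans 100≤σ σ≤τ) 32σ≤τ
      -- Numerically, (1.001 · 256/225)^4 is about 1.68, below 7/4.
      (≤ᵇ⇒≤ (4 * (1001 * (16 * 16)) ^ 4) (7 * (1000 * (15 * 15)) ^ 4) _))
  ratio : 4 * 1001 ^ t ≤ 1000 ^ t * (2 ^ σ * 2 ^ σ)
  ratio = ≤-trans
    -- Numerically, 1.001^1024 is about 2.78, below 3.
    (4·ratio≤4^ {1000} {1001} 1024 σ t (n≤1+n 1000) (≤ᵇ⇒≤ (1001 ^ 1024) (3 * 1000 ^ 1024) _) (≤-trans (≤ᵇ⇒≤ 5 100 _) 100≤σ) t≤1024σ)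
    (≤-reflexive (cong (1000 ^ t *_) (^-distrib-* 2 2 σ)))

theorem4 : ∀ (N : ℕ) → ∃ λ (t : ℕ) → N ≤ t × 0 < t ×
    ∃ λ (n : ℕ) → ∃ λ (m : ℕ) → IsRamsey t n × IsOnlineRamsey t m ×
    1001 ^ t * m ≤ 1000 ^ t * (n C 2)
theorem4 N =
  -- The summand `N` makes t large; 100 is where 256n · 7^n ≤ 8^n is anchored.
  let σ = N + 100
      100≤σ = m≤n+m 100 N
      0<σ   = ≤-trans (s≤s z≤n) 100≤σ
      -- The rates compare as 1 + 224 + 8 · 32 = 481 ≤ 512 = 2 · (32 + 224).
      j , 32≤j , j<256 , gR₀≤R = gap σ 32 224 0<σ (s≤s z≤n) (≤ᵇ⇒≤ 481 512 _)
      t = 4 * (σ * suc j)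
      σ≤t   = ≤-trans (m≤m*n σ (suc j)) (m≤n*m (σ * suc j) 4)
      m , online , small = online-gap σ j 100≤σ 32≤j j<256 gR₀≤R
  in t , ≤-trans (m≤m+n N 100) σ≤t , ≤-trans 0<σ σ≤t , r t , m , r-isRamsey t , online , small
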